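{- There is an algorithm that, given a definite Horn CNF $\Psi$ over the variable set $V$, generates all implicate sets of $\Psi$ with polynomial delay.
   Context: $V$ is a finite set of Boolean variables; a Boolean function on $V$ is a map $2^V\to\{0,1\}$, and its true sets are the sets on which it equals $1$. Write $f\le g$ if $f(X)\le g(X)$ for all $X\subseteq V$. For $B\subsetneq V$ and $v\in V\setminus B$, the definite Horn clause $B\to v$ has as true sets the sets $T$ with $B\not\subseteq T$ or $B\cup\{v\}\subseteq T$. A definite Horn CNF is a finite conjunction of definite Horn clauses. A clause $B\to v$ is an implicate of $\Psi$ if $\Psi\le(B\to v)$ as Boolean functions. A set $I\subseteq V$ is an implicate set of $\Psi$ if $(I\setminus\{v\})\to v$ is an implicate of $\Psi$ for all $v\in I$. A generation algorithm (outputting each required object) has polynomial delay if the time intervals between the start and the first output, between consecutive outputs, and between the last output and the halt are all bounded by a polynomial in the input size. -}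

module Defs where

open import Data.Bool.Base using (Bool; true; false) renaming (_≤_ to _≤ᵇ_)
open import Data.Bool.ListAction using (all)
open import Data.Fin.Base using (Fin; zero; suc)
open import Data.Fin.Subset using (Subset; _∈_; _∉_; _∪_; _-_; ⁅_⁆; inside; outside)
open import Data.Fin.Subset.Properties using (_⊆?_)
open import Data.List.Base using (List; []; _∷_; _++_; map; replicate)
open import Data.List.Membership.Propositional using () renaming (_∈_ to _∈ˡ_)
open import Data.List.Relation.Unary.All using (All)
open import Data.List.Relation.Unary.Unique.Propositional using (Unique)
open import Data.Nat.Base using (ℕ; zero; suc; _+_; _*_; _≤_)
open import Data.Product.Base using (∃)
open import Data.Vec.Base using (Vec; []; _∷_; lookup; _[_]≔_; here; there) renaming (replicate to replicateⱽ; toList to toListⱽ)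
open import Function.Bundles using (_⇔_)
open import Relation.Binary.PropositionalEquality using (_≡_; _≢_)
open import Relation.Nullary.Decidable using (⌊_⌋; ¬?; _⊎-dec_)

------------------------------------------------------------------------
-- Definite Horn CNFs over the variable set V = Fin n

BooleanFunction : ℕ → Set
BooleanFunction n = Subset n → Bool

infix 4 _≤ᶠ_
_≤ᶠ_ : ∀ {n} → BooleanFunction n → BooleanFunction n → Set
f ≤ᶠ g = ∀ X → f X ≤ᵇ g X

-- B ⊊ V is implied by head∉body.
record Clause (n : ℕ) : Set where
  constructor _⟶_⟨_⟩
  field
    body      : Subset n
    head      : Fin n
    head∉body : head ∉ body

open Clause public

⟦_⟧ᶜ : ∀ {n} → Clause n → BooleanFunction n
⟦ B ⟶ v ⟨ _ ⟩ ⟧ᶜ T = ⌊ ¬? (B ⊆? T) ⊎-dec ((B ∪ ⁅ v ⁆) ⊆? T) ⌋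

CNF : ℕ → Set
CNF n = List (Clause n)

⟦_⟧ : ∀ {n} → CNF n → BooleanFunction n
⟦ Ψ ⟧ T = all (λ C → ⟦ C ⟧ᶜ T) Ψ

IsImplicate : ∀ {n} → CNF n → Clause n → Set
IsImplicate Ψ C = ⟦ Ψ ⟧ ≤ᶠ ⟦ C ⟧ᶜ

x∉p-x : ∀ {n} (p : Subset n) (x : Fin n) → x ∉ p - x
x∉p-x (outside ∷ p) zero    ()
x∉p-x (inside  ∷ p) zero    ()
x∉p-x (_       ∷ p) (suc x) (there x∈) = x∉p-x p x x∈

IsImplicateSet : ∀ {n} → CNF n → Subset n → Set
IsImplicateSet Ψ I = ∀ v → v ∈ I → IsImplicate Ψ ((I - v) ⟶ v ⟨ x∉p-x I v ⟩)

------------------------------------------------------------------------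
-- Model of computation: Jones's WHILE language over binary trees,
-- extended with an output command.  Trees are thought of as pointers to
-- shared immutable cells, so each constructor or destructor application
-- and each variable access takes unit time; with this measure the model
-- is polynomially equivalent to Turing machines.

infixr 5 _∙_
data Tree : Set where
  nil : Tree
  _∙_ : Tree → Tree → Tree

size : Tree → ℕ
size nil     = 1
size (l ∙ r) = suc (size l + size r)

data Expr (k : ℕ) : Set where
  var   : Fin k → Expr k
  nil   : Expr k
  cons  : Expr k → Expr k → Expr k
  hd tl : Expr k → Expr k

infix  6 _:=_
infixr 5 _⨾_
data Cmd (k : ℕ) : Set where
  skip          : Cmd k
  _:=_          : Fin k → Expr k → Cmd k
  _⨾_           : Cmd k → Cmd k → Cmd k
  if_then_else_ : Expr k → Cmd k → Cmd k → Cmd k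
  while_loop_     : Expr k → Cmd k → Cmd k
  emit          : Expr k → Cmd k

Store : ℕ → Set
Store k = Vec Tree k

head′ tail′ : Tree → Tree
head′ nil     = nil
head′ (l ∙ _) = l
tail′ nil     = nil
tail′ (_ ∙ r) = r

eval : ∀ {k} → Expr k → Store k → Tree
eval (var x)    σ = lookup σ x
eval nil        σ = nil
eval (cons e f) σ = eval e σ ∙ eval f σ
eval (hd e)     σ = head′ (eval e σ)
eval (tl e)     σ = tail′ (eval e σ)

cost : ∀ {k} → Expr k → ℕ
cost (var _)    = 1
cost nil        = 1
cost (cons e f) = suc (cost e + cost f)
cost (hd e)     = suc (cost e)
cost (tl e)     = suc (cost e)

-- A trace records a whole run: the time units spent, interleaved with
-- the objects output.
data Event : Set where
  tick   : Event
  output : Tree → Event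

Trace : Set
Trace = List Event

ticks : ℕ → Trace
ticks t = replicate t tick

-- ⟨ c , σ ⟩⇓⟨ τ , σ′ ⟩: started in σ, c halts in σ′ and has trace τ.
-- Any tree other than nil counts as true.  Sharing would allow a small
-- store to denote a huge tree, hence output is charged its full size.
infix 4 ⟨_,_⟩⇓⟨_,_⟩
data ⟨_,_⟩⇓⟨_,_⟩ {k : ℕ} : Cmd k → Store k → Trace → Store k → Set where

  ⇓-skip : ∀ {σ} → ⟨ skip , σ ⟩⇓⟨ ticks 1 , σ ⟩

  ⇓-assign : ∀ {x e σ} →
    ⟨ x := e , σ ⟩⇓⟨ ticks (suc (cost e)) , σ [ x ]≔ eval e σ ⟩

  ⇓-seq : ∀ {c d σ σ′ σ″ τ τ′} →
    ⟨ c , σ ⟩⇓⟨ τ , σ′ ⟩ →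
    ⟨ d , σ′ ⟩⇓⟨ τ′ , σ″ ⟩ →
    ⟨ c ⨾ d , σ ⟩⇓⟨ τ ++ τ′ , σ″ ⟩

  ⇓-if-true : ∀ {e c d σ σ′ τ} →
    eval e σ ≢ nil →
    ⟨ c , σ ⟩⇓⟨ τ , σ′ ⟩ →
    ⟨ if e then c else d , σ ⟩⇓⟨ ticks (suc (cost e)) ++ τ , σ′ ⟩

  ⇓-if-false : ∀ {e c d σ σ′ τ} →
    eval e σ ≡ nil →
    ⟨ d , σ ⟩⇓⟨ τ , σ′ ⟩ →
    ⟨ if e then c else d , σ ⟩⇓⟨ ticks (suc (cost e)) ++ τ , σ′ ⟩

  ⇓-while-true : ∀ {e c σ σ′ σ″ τ τ′} →
    eval e σ ≢ nil →
    ⟨ c , σ ⟩⇓⟨ τ , σ′ ⟩ →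
    ⟨ while e loop c , σ′ ⟩⇓⟨ τ′ , σ″ ⟩ →
    ⟨ while e loop c , σ ⟩⇓⟨ ticks (suc (cost e)) ++ τ ++ τ′ , σ″ ⟩

  ⇓-while-false : ∀ {e c σ} →
    eval e σ ≡ nil →
    ⟨ while e loop c , σ ⟩⇓⟨ ticks (suc (cost e)) , σ ⟩

  ⇓-emit : ∀ {e σ} →
    ⟨ emit e , σ ⟩⇓⟨ ticks (cost e + size (eval e σ)) ++ output (eval e σ) ∷ [] , σ ⟩

record Program : Set where
  constructor program
  field
    auxiliaries : ℕ
    code        : Cmd (suc auxiliaries)

open Program public

-- The input is placed in variable zero; all other variables hold nil.
infix 4 _on_↝_
_on_↝_ : Program → Tree → Trace → Set
P on t ↝ τ = ∃ λ σ → ⟨ code P , t ∷ replicateⱽ (auxiliaries P) nil ⟩⇓⟨ τ , σ ⟩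

------------------------------------------------------------------------
-- Polynomial delay

outputs : Trace → List Tree
outputs []             = []
outputs (tick     ∷ τ) = outputs τ
outputs (output t ∷ τ) = t ∷ outputs τ

-- The lengths of all intervals of a run: from the start to the first
-- output, between consecutive outputs, and from the last output to the
-- halt.  The first argument is the time already spent in the current one.
intervalsFrom : ℕ → Trace → List ℕ
intervalsFrom t []             = t ∷ []
intervalsFrom t (tick     ∷ τ) = intervalsFrom (suc t) τ
intervalsFrom t (output _ ∷ τ) = t ∷ intervalsFrom 0 τ

intervals : Trace → List ℕ
intervals = intervalsFrom 0

-- Coefficients, constant term first.
Polynomial : Set
Polynomial = List ℕ

_at_ : Polynomial → ℕ → ℕ
[]      at x = 0
(a ∷ p) at x = a + x * (p at x)

record GeneratesWithDelay {A : Set} (P : Program) (input : Tree)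
         (encode : A → Tree) (Required : A → Set) (delay : ℕ) : Set where
  field
    trace      : Trace
    runs       : P on input ↝ trace
    objects    : List A
    outputs≡   : outputs trace ≡ map encode objects
    required   : ∀ x → x ∈ˡ objects ⇔ Required x
    unique     : Unique objects
    intervals≤ : All (_≤ delay) (intervals trace)

------------------------------------------------------------------------
-- Encodings as trees

listTree : List Tree → Tree
listTree []       = nil
listTree (t ∷ ts) = t ∙ listTree ts

boolTree : Bool → Tree
boolTree false = nil
boolTree true  = nil ∙ nil

subsetTree : ∀ {n} → Subset n → Tree
subsetTree X = listTree (map boolTree (toListⱽ X))

-- The incidence vectors of the negative and of the positive literals.
clauseTree : ∀ {n} → Clause n → Tree
clauseTree C = subsetTree (body C) ∙ subsetTree ⁅ head C ⁆

-- V is given as a list of n nils, since Ψ need not mention every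
-- variable.
cnfTree : ∀ {n} → CNF n → Tree
cnfTree {n} Ψ = listTree (replicate n nil) ∙ listTree (map clauseTree Ψ)

{-# OPTIONS --safe #-}

-- If I and J are implicate sets then so is I ∪ J, because the closure under
-- forward chaining is monotone.  Hence every set X contains a largest
-- implicate set, its interior, obtained from X by repeatedly deleting some
-- v that is not in the closure of X - v.  The implicate sets are listed in
-- decreasing lexicographic order, starting with the interior of V.  The
-- successor of S is the interior of (S ∩ [0,i)) ∪ (i,n), for the largest
-- i ∈ S such that this interior still contains S ∩ [0,i).  Every successor thus
-- takes polynomially many interiors.

module Submission where

open import Defs
open import Data.Nat.Base using (ℕ)
open import Data.Product.Base using (Σ-syntax)

open import Data.Bool.Base using (Bool; true; false; T; _∧_; f≤t; b≤b)
  renaming (if_then_else_ to ifᵇ_then_else_; _≤_ to _≤ᵇ_)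
open import Data.Bool.Properties using (if-∧; if-eta; if-float)
import Data.Empty as Empty
open import Data.Fin.Base using (Fin; zero; suc; toℕ) renaming (_<_ to _<ᶠ_)
open import Data.Fin.Properties using (toℕ-injective)
open import Data.Fin.Subset using (Subset; inside; outside; _∈_; _∉_; _⊆_; _∪_; _─_; _-_; ⁅_⁆; ⊤; ⊥; ∁; ∣_∣)
open import Data.Fin.Subset.Properties
open import Data.List.Base using (List; []; _∷_; [_]; _++_; _ʳ++_; replicate; map; length; foldl; allFin; tabulate)
open import Data.List.Properties using (++-assoc; ++-identityʳ; length-map; length-ʳ++; ʳ++-ʳ++)
open import Data.List.Membership.Propositional using () renaming (_∈_ to _∈ˡ_)
open import Data.List.Membership.Propositional.Properties using (∈-allFin)
open import Data.List.Relation.Unary.All as All using (All; []; _∷_)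
open import Data.List.Relation.Unary.All.Properties using (all⁺; all⁻)
open import Data.List.Relation.Unary.Any using (here; there)
open import Data.List.Relation.Unary.AllPairs using ([]; _∷_)
open import Data.List.Relation.Unary.Unique.Propositional using (Unique)
open import Data.Maybe.Base using (Maybe; just; nothing)
open import Data.Nat.Base using (zero; suc; _+_; _*_; _^_; _≤_; _<_; z≤n; s≤s)
open import Data.Nat.Induction using (<-wellFounded)
open import Data.Nat.Properties
open import Data.Nat.Tactic.RingSolver using (solve-∀)
open import Data.Product.Base using (∃; _×_; _,_; proj₁; proj₂)
open import Data.Sum.Base using (_⊎_; inj₁; inj₂)
open import Data.Vec.Base using ([]; _∷_; lookup; _[_]≔_; toList; here; there)
open import Data.Vec.Properties using (length-toList)
open import Function.Base using (_∘_; case_of_)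
open import Function.Bundles using (_⇔_; mk⇔; Equivalence)
open import Induction.WellFounded using (Acc; acc)
open import Relation.Binary.Definitions using (tri<; tri≈; tri>)
open import Relation.Binary.PropositionalEquality hiding ([_])
open import Relation.Nullary using (¬_; yes; no; contradiction; does)
open import Relation.Nullary.Decidable using (toWitness; fromWitness)
open Equivalence using (to; from)

-- An implicate set that first leaves `S` at `i` lies inside the set whose interior is tested at
-- `i`. If one exists, the interior contains it, and with it `S ∩ [0,i)`. So the test fails only
-- where no implicate set branches off, and a success is itself the next output: the search has no
-- dead ends. The largest `i` is right because a set that agrees with `S` longer comes earlier in
-- the list. Only the current set is stored; strict decrease rules out repetitions.
--
-- The delay has to be proved for an actual program. All work between two outputs is therefore
-- written in a language whose only loops run along a list of the input, so that a polynomial bound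
-- can be read off the syntax, whatever trees arise on the way. Fixed points are then reached by `n`
-- sweeps instead of iteration until nothing changes, and searches have no early exit. Only the
-- outermost loop, which may make exponentially many rounds, is a free `while`.

private
  variable
    k n : ℕ
    A B : Set

-- Iterated sweeps

repeat : ℕ → (A → A) → A → A
repeat zero    f x = x
repeat (suc k) f x = repeat k f (f x)

saturate : ℕ → (A → B → A) → List B → A → A
saturate k h xs = repeat k (λ x → foldl h x xs)

repeat-fixed : ∀ k {f : A → A} {x} → f x ≡ x → repeat k f x ≡ x
repeat-fixed zero    fx≡x = refl
repeat-fixed (suc k) {f} fx≡x = trans (cong (repeat k f) fx≡x) (repeat-fixed k fx≡x)

foldl-preserves : ∀ {h : A → B → A} {P : A → Set} xs →
                  (∀ {x b} → b ∈ˡ xs → P x → P (h x b)) → ∀ {x} → P x → P (foldl h x xs)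
foldl-preserves []       step px = px
foldl-preserves {P = P} (b ∷ xs) step px =
  foldl-preserves {P = P} xs (step ∘ there) (step (here refl) px)

saturate-preserves : ∀ k {h : A → B → A} {P : A → Set} xs →
                     (∀ {x b} → b ∈ˡ xs → P x → P (h x b)) → ∀ {x} → P x → P (saturate k h xs x)
saturate-preserves zero    xs step px = px
saturate-preserves (suc k) {P = P} xs step px =
  saturate-preserves k {P = P} xs step (foldl-preserves {P = P} xs step px)

-- A sweep either changes nothing or lowers the measure, so `measure x` sweeps reach a fixed point.
-- It serves both the growing `closure` and the shrinking `interior`.
module Descent {A B : Set} (_⊑_ : A → A → Set)
  (⊑-refl : ∀ {x} → x ⊑ x) (⊑-trans : ∀ {x y z} → x ⊑ y → y ⊑ z → x ⊑ z)
  (measure : A → ℕ) (⊑⇒≡⊎< : ∀ {x y} → x ⊑ y → x ≡ y ⊎ measure x < measure y)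
  (h : A → B → A) (h-⊑ : ∀ x b → h x b ⊑ x) where

  foldl-⊑ : ∀ xs x → foldl h x xs ⊑ x
  foldl-⊑ []       x = ⊑-refl
  foldl-⊑ (b ∷ xs) x = ⊑-trans (foldl-⊑ xs (h x b)) (h-⊑ x b)

  ⊑-antisym : ∀ {x y} → x ⊑ y → y ⊑ x → x ≡ y
  ⊑-antisym x⊑y y⊑x with ⊑⇒≡⊎< x⊑y | ⊑⇒≡⊎< y⊑x
  ... | inj₁ x≡y | _        = x≡y
  ... | inj₂ x<y | inj₁ y≡x = sym y≡x
  ... | inj₂ x<y | inj₂ y<x = contradiction y<x (<-asym x<y)

  -- The values along a sweep descend, so a sweep that ends where it began cannot have moved at any
  -- step, by antisymmetry.
  foldl-fixed : ∀ xs {x} → foldl h x xs ≡ x → ∀ {b} → b ∈ˡ xs → h x b ≡ x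
  foldl-fixed (c ∷ xs) {x} fixed = λ where
      (here refl) → hxc≡x
      (there b∈)  → foldl-fixed xs (subst (λ y → foldl h y xs ≡ x) hxc≡x fixed) b∈
    where
    hxc≡x : h x c ≡ x
    hxc≡x = ⊑-antisym (h-⊑ x c) (subst (_⊑ h x c) fixed (foldl-⊑ xs (h x c)))

  saturate-stable : ∀ k xs x → measure x ≤ k →
                    foldl h (saturate k h xs x) xs ≡ saturate k h xs x
  saturate-stable k xs x m≤k with ⊑⇒≡⊎< (foldl-⊑ xs x)
  saturate-stable zero    xs x m≤k | inj₁ eq   = eq
  saturate-stable (suc k) xs x m≤k | inj₁ eq   =
    subst (λ y → foldl h y xs ≡ y) (sym (repeat-fixed (suc k) eq)) eq
  saturate-stable zero    xs x m≤k | inj₂ lt   = contradiction (<-≤-trans lt m≤k) λ ()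
  saturate-stable (suc k) xs x m≤k | inj₂ lt   =
    saturate-stable k xs (foldl h x xs) (≤-pred (<-≤-trans lt m≤k))

  saturate-fixed : ∀ k xs x → measure x ≤ k → ∀ {b} → b ∈ˡ xs →
                   h (saturate k h xs x) b ≡ saturate k h xs x
  saturate-fixed k xs x m≤k = foldl-fixed xs (saturate-stable k xs x m≤k)

-- Inclusion, cardinality and difference of subsets

⊆⇒≡⊎∣∣< : ∀ {p q : Subset n} → p ⊆ q → p ≡ q ⊎ ∣ p ∣ < ∣ q ∣
⊆⇒≡⊎∣∣< {p = p} {q} p⊆q with q ⊆? p
... | yes q⊆p = inj₁ (⊆-antisym p⊆q q⊆p)
... | no  q⊈p with ∣ p ∣ <? ∣ q ∣
...   | yes lt = inj₂ lt
...   | no  ¬lt = contradiction (λ {x} → q⊆p′ {x}) q⊈p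
  where
  q⊆p′ : q ⊆ p
  q⊆p′ {x} x∈q with x ∈? p
  ... | yes x∈p = x∈p
  ... | no  x∉p = contradiction (p⊂q⇒∣p∣<∣q∣ (p⊆q , x , x∈q , x∉p)) ¬lt

⊇⇒≡⊎∣∁∣< : ∀ {p q : Subset n} → q ⊆ p → p ≡ q ⊎ ∣ ∁ p ∣ < ∣ ∁ q ∣
⊇⇒≡⊎∣∁∣< q⊆p with ⊆⇒≡⊎∣∣< (p⊆q⇒∁p⊇∁q q⊆p)
... | inj₁ ∁p≡∁q = inj₁ (⊆-antisym (∁p⊆∁q⇒p⊇q (⊆-reflexive (sym ∁p≡∁q))) q⊆p)
... | inj₂ lt    = inj₂ lt

x∈p─q⇒x∉q : ∀ (p q : Subset n) {x} → x ∈ p ─ q → x ∉ q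
x∈p─q⇒x∉q (_ ∷ p) (inside  ∷ q) (there x∈) (there x∈q) = x∈p─q⇒x∉q p q x∈ x∈q
x∈p─q⇒x∉q (_ ∷ p) (outside ∷ q) (there x∈) (there x∈q) = x∈p─q⇒x∉q p q x∈ x∈q

─-monoˡ-⊆ : ∀ {p q : Subset n} r → p ⊆ q → p ─ r ⊆ q ─ r
─-monoˡ-⊆ {p = p} r p⊆q x∈ = x∈p∧x∉q⇒x∈p─q (p⊆q (p─q⊆p p r x∈)) (x∈p─q⇒x∉q p r x∈)

-- Forward chaining

Closed : Clause n → Subset n → Set
Closed C M = body C ⊆ M → head C ∈ M

⟦⟧ᶜ⇔Closed : ∀ (C : Clause n) M → T (⟦ C ⟧ᶜ M) ⇔ Closed C M
⟦⟧ᶜ⇔Closed C M = mk⇔ sound complete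
  where
  sound : T (⟦ C ⟧ᶜ M) → Closed C M
  sound t B⊆M with toWitness t
  ... | inj₁ B⊈M = contradiction (λ {x} → B⊆M {x}) B⊈M
  ... | inj₂ all = all (x∈p∪q⁺ (inj₂ (x∈⁅x⁆ (head C))))
  complete : Closed C M → T (⟦ C ⟧ᶜ M)
  complete closed = fromWitness (decide (body C ⊆? M))
    where
    decide : _ → ¬ (body C ⊆ M) ⊎ body C ∪ ⁅ head C ⁆ ⊆ M
    decide (no  B⊈M) = inj₁ B⊈M
    decide (yes B⊆M) = inj₂ λ x∈ → union (x∈p∪q⁻ (body C) ⁅ head C ⁆ x∈)
      where
      union : ∀ {x} → x ∈ body C ⊎ x ∈ ⁅ head C ⁆ → x ∈ M
      union (inj₁ x∈B) = B⊆M x∈B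
      union (inj₂ x∈h) = subst (_∈ M) (sym (x∈⁅y⁆⇒x≡y _ x∈h)) (closed B⊆M)

≤ᵇ⇔T→T : ∀ {a b} → a ≤ᵇ b ⇔ (T a → T b)
≤ᵇ⇔T→T {false} {false} = mk⇔ (λ _ ()) (λ _ → b≤b)
≤ᵇ⇔T→T {false} {true}  = mk⇔ (λ _ ()) (λ _ → f≤t)
≤ᵇ⇔T→T {true}  {true}  = mk⇔ (λ _ _ → _) (λ _ → b≤b)
≤ᵇ⇔T→T {true}  {false} = mk⇔ (λ ()) (λ f → contradiction (f _) λ ())

fire : Subset n → Clause n → Subset n
fire X C = ifᵇ does (body C ⊆? X) then X ∪ ⁅ head C ⁆ else X

closure : CNF n → Subset n → Subset n
closure {n} = saturate n fire

⊆-fire : ∀ (X : Subset n) C → X ⊆ fire X C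
⊆-fire X C with body C ⊆? X
... | yes _ = p⊆p∪q ⁅ head C ⁆
... | no  _ = λ x∈ → x∈

fire-least : ∀ {X M : Subset n} C → Closed C M → X ⊆ M → fire X C ⊆ M
fire-least {X = X} {M} C closed X⊆M with body C ⊆? X
... | no  _   = X⊆M
... | yes B⊆X = λ x∈ → union (x∈p∪q⁻ X ⁅ head C ⁆ x∈)
  where
  union : ∀ {x} → x ∈ X ⊎ x ∈ ⁅ head C ⁆ → x ∈ M
  union (inj₁ x∈X) = X⊆M x∈X
  union (inj₂ x∈h) = subst (_∈ M) (sym (x∈⁅y⁆⇒x≡y _ x∈h)) (closed (⊆-trans B⊆X X⊆M))

fire-fixed⇒Closed : ∀ (X : Subset n) C → fire X C ≡ X → Closed C X
fire-fixed⇒Closed X C fixed B⊆X with body C ⊆? X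
... | yes _   = subst (head C ∈_) fixed (q⊆p∪q X ⁅ head C ⁆ (x∈⁅x⁆ (head C)))
... | no  B⊈X = contradiction (λ {x} → B⊆X {x}) B⊈X

module _ {n : ℕ} (Ψ : CNF n) where

  Model : Subset n → Set
  Model M = ∀ {C} → C ∈ˡ Ψ → Closed C M

  ⟦⟧⇔Model : ∀ M → T (⟦ Ψ ⟧ M) ⇔ Model M
  ⟦⟧⇔Model M = mk⇔
    (λ t {C} C∈ → to (⟦⟧ᶜ⇔Closed C M) (All.lookup (all⁺ _ Ψ t) C∈))
    (λ model → all⁻ _ (All.tabulate (λ {C} C∈ → from (⟦⟧ᶜ⇔Closed C M) (model C∈))))

  ⊆-closure : ∀ X → X ⊆ closure Ψ X
  ⊆-closure X = saturate-preserves n {P = X ⊆_} Ψ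
    (λ {Y} {C} _ X⊆Y → ⊆-trans X⊆Y (⊆-fire Y C)) ⊆-refl

  closure-least : ∀ {X M} → Model M → X ⊆ M → closure Ψ X ⊆ M
  closure-least {M = M} model = saturate-preserves n {P = _⊆ M} Ψ
    (λ {_} {C} C∈ → fire-least C (model C∈))

  closure-model : ∀ X → Model (closure Ψ X)
  closure-model X {C} C∈ = fire-fixed⇒Closed _ C (saturate-fixed n Ψ X (∣p∣≤n (∁ X)) C∈)
    -- Forward chaining ascends, so inclusion is reversed and the measure counts the missing
    -- elements, at most `n`.
    where open Descent {A = Subset n} {B = Clause n} (λ p q → q ⊆ p) ⊆-refl (λ q⊆p r⊆q → ⊆-trans r⊆q q⊆p)
                       (λ p → ∣ ∁ p ∣) ⊇⇒≡⊎∣∁∣< fire ⊆-fire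

  closure-mono : ∀ {X Y} → X ⊆ Y → closure Ψ X ⊆ closure Ψ Y
  closure-mono {Y = Y} X⊆Y = closure-least (closure-model Y) (⊆-trans X⊆Y (⊆-closure Y))

  -- The closure of the body is the least model containing it: an implicate can be tested on this
  -- one model, and every model containing the body contains the closure.
  implicate⇔∈closure : ∀ C → IsImplicate Ψ C ⇔ head C ∈ closure Ψ (body C)
  implicate⇔∈closure C = mk⇔ complete sound
    where
    M = closure Ψ (body C)
    complete : IsImplicate Ψ C → head C ∈ M
    complete implicate =
      to (⟦⟧ᶜ⇔Closed C M)
        (to ≤ᵇ⇔T→T (implicate M) (from (⟦⟧⇔Model M) (closure-model (body C))))
        (⊆-closure (body C))
    sound : head C ∈ M → IsImplicate Ψ C
    sound h∈ X = from ≤ᵇ⇔T→T λ t →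
      from (⟦⟧ᶜ⇔Closed C X) λ B⊆X → closure-least (to (⟦⟧⇔Model X) t) B⊆X h∈

  SelfSupporting : Subset n → Set
  SelfSupporting I = ∀ v → v ∈ I → v ∈ closure Ψ (I - v)

  implicateSet⇔ : ∀ I → IsImplicateSet Ψ I ⇔ SelfSupporting I
  implicateSet⇔ I = mk⇔
    (λ implicates v v∈ → to (implicate⇔∈closure (rule v)) (implicates v v∈))
    (λ sup v v∈ → from (implicate⇔∈closure (rule v)) (sup v v∈))
    where
    rule : ∀ v → Clause n
    rule v = (I - v) ⟶ v ⟨ x∉p-x I v ⟩

  -- The largest implicate set contained in a set

  -- Membership of `v` is phrased as inclusion of `⁅ v ⁆`, so that the program can use its one
  -- subset test.
  prune : Subset n → Fin n → Subset n
  prune X v = ifᵇ does (⁅ v ⁆ ⊆? closure Ψ (X - v)) then X else X - v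

  interior : Subset n → Subset n
  interior = saturate n prune (allFin n)

  prune-⊆ : ∀ X v → prune X v ⊆ X
  prune-⊆ X v with ⁅ v ⁆ ⊆? closure Ψ (X - v)
  ... | yes _ = λ x∈ → x∈
  ... | no  _ = p─q⊆p X ⁅ v ⁆

  -- If `v ∈ I`, then `v` lies in the closure of `I - v`, hence in that of the larger `X - v`, and
  -- is not deleted.
  prune-greatest : ∀ {I X} v → SelfSupporting I → I ⊆ X → I ⊆ prune X v
  prune-greatest {I} {X} v sup I⊆X with ⁅ v ⁆ ⊆? closure Ψ (X - v)
  ... | yes _ = I⊆X
  ... | no ⁅v⁆⊈ = λ x∈I → x∈p∧x≢y⇒x∈p-y (I⊆X x∈I) λ { refl → ⁅v⁆⊈ λ y∈ →
      subst (_∈ closure Ψ (X - v)) (sym (x∈⁅y⁆⇒x≡y v y∈))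
        (closure-mono (─-monoˡ-⊆ ⁅ v ⁆ I⊆X) (sup v x∈I)) }

  prune-fixed : ∀ X v → prune X v ≡ X → v ∈ X → v ∈ closure Ψ (X - v)
  prune-fixed X v fixed v∈X with ⁅ v ⁆ ⊆? closure Ψ (X - v)
  ... | yes ⁅v⁆⊆ = ⁅v⁆⊆ (x∈⁅x⁆ v)
  ... | no  _    = contradiction (subst (v ∈_) (sym fixed) v∈X) (x∉p-x X v)

  interior-⊆ : ∀ X → interior X ⊆ X
  interior-⊆ X = saturate-preserves n {P = _⊆ X} (allFin n)
    (λ {Y} {v} _ Y⊆X → ⊆-trans (prune-⊆ Y v) Y⊆X) ⊆-refl

  interior-greatest : ∀ {I X} → SelfSupporting I → I ⊆ X → I ⊆ interior X
  interior-greatest {I} sup = saturate-preserves n {P = I ⊆_} (allFin n)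
    (λ {_} {v} _ → prune-greatest v sup)

  interior-selfSupporting : ∀ X → SelfSupporting (interior X)
  interior-selfSupporting X v =
    prune-fixed _ v (saturate-fixed n (allFin n) X (∣p∣≤n X) (∈-allFin v))
    where open Descent {A = Subset n} {B = Fin n} _⊆_ ⊆-refl ⊆-trans ∣_∣ ⊆⇒≡⊎∣∣< prune prune-⊆

-- The decreasing lexicographic order

-- With these sets, prefixes and singletons become differences: `S ─ upper i` is the part of `S`
-- below `i`, and `upper i ─ upper (suc i)` is the singleton of `i`. The argument is a natural
-- number because `suc (toℕ i)` may equal `n`.
upper : ℕ → Subset n
upper zero                = ⊤
upper {zero}      (suc i) = []
upper {n = suc _} (suc i) = outside ∷ upper i

∈-upper⁺ : ∀ i {j : Fin n} → i ≤ toℕ j → j ∈ upper i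
∈-upper⁺ zero            i≤j       = ∈⊤
∈-upper⁺ (suc i) {suc j} (s≤s i≤j) = there (∈-upper⁺ i i≤j)

∈-upper⁻ : ∀ i {j : Fin n} → j ∈ upper i → i ≤ toℕ j
∈-upper⁻ zero            j∈         = z≤n
∈-upper⁻ (suc i) {suc j} (there j∈) = s≤s (∈-upper⁻ i j∈)

-- X precedes Y because i is the first element in which they differ.
record Differ (i : Fin n) (X Y : Subset n) : Set where
  field
    ∉ˡ     : i ∉ X
    ∈ʳ     : i ∈ Y
    agree→ : ∀ {j} → j <ᶠ i → j ∈ X → j ∈ Y
    agree← : ∀ {j} → j <ᶠ i → j ∈ Y → j ∈ X

open Differ

infix 4 _≺_
_≺_ : Subset n → Subset n → Set
X ≺ Y = ∃ λ i → Differ i X Y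

-- The incidence vector as a binary numeral, first element most significant. It embeds `≺` into `<`,
-- which gives termination and irreflexivity.
value : Subset n → ℕ
value             []            = 0
value             (outside ∷ X) = value X
value {n = suc n} (inside  ∷ X) = 2 ^ n + value X

value<2^n : ∀ (X : Subset n) → value X < 2 ^ n
value<2^n []                        = s≤s z≤n
value<2^n {n = suc n} (outside ∷ X) = <-≤-trans (value<2^n X) (m≤m+n (2 ^ n) (2 ^ n + 0))
value<2^n {n = suc n} (inside  ∷ X) =
  +-monoʳ-< (2 ^ n) (<-≤-trans (value<2^n X) (≤-reflexive (sym (+-identityʳ (2 ^ n)))))

differ-there : ∀ {x y} {X Y : Subset n} {i} → Differ (suc i) (x ∷ X) (y ∷ Y) → Differ i X Y
differ-there d = record
  { ∉ˡ     = ∉ˡ d ∘ there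
  ; ∈ʳ     = drop-there (∈ʳ d)
  ; agree→ = λ j<i → drop-there ∘ agree→ d (s≤s j<i) ∘ there
  ; agree← = λ j<i → drop-there ∘ agree← d (s≤s j<i) ∘ there
  }

differ-suc : ∀ x {X Y : Subset n} {i} → Differ i X Y → Differ (suc i) (x ∷ X) (x ∷ Y)
differ-suc x d = record
  { ∉ˡ     = ∉ˡ d ∘ drop-there
  ; ∈ʳ     = there (∈ʳ d)
  ; agree→ = λ { {zero}  _         here       → here
               ; {suc j} (s≤s j<i) (there j∈) → there (agree→ d j<i j∈) }
  ; agree← = λ { {zero}  _         here       → here
               ; {suc j} (s≤s j<i) (there j∈) → there (agree← d j<i j∈) }
  }

differ⇒value< : ∀ {i} {X Y : Subset n} → Differ i X Y → value X < value Y
differ⇒value< {i = zero}  {inside  ∷ X} {y ∷ Y}       d = contradiction here (∉ˡ d)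
differ⇒value< {i = zero}  {outside ∷ X} {outside ∷ Y} d = contradiction (∈ʳ d) λ ()
differ⇒value< {i = zero}  {outside ∷ X} {inside ∷ Y}  d = <-≤-trans (value<2^n X) (m≤m+n _ _)
differ⇒value< {i = suc i} {outside ∷ X} {outside ∷ Y} d = differ⇒value< (differ-there d)
differ⇒value< {i = suc i} {inside ∷ X}  {inside ∷ Y}  d = +-monoʳ-< _ (differ⇒value< (differ-there d))
differ⇒value< {i = suc i} {outside ∷ X} {inside ∷ Y}  d = contradiction (agree← d (s≤s z≤n) here) λ ()
differ⇒value< {i = suc i} {inside ∷ X}  {outside ∷ Y} d = contradiction (agree→ d (s≤s z≤n) here) λ ()

⊆⇒≡⊎≺ : ∀ {X Y : Subset n} → X ⊆ Y → X ≡ Y ⊎ X ≺ Y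
⊆⇒≡⊎≺ {X = []}          {[]}          X⊆Y = inj₁ refl
⊆⇒≡⊎≺ {X = inside ∷ X}  {outside ∷ Y} X⊆Y = contradiction (X⊆Y here) λ ()
⊆⇒≡⊎≺ {X = outside ∷ X} {inside ∷ Y}  X⊆Y =
  inj₂ (zero , record { ∉ˡ = λ () ; ∈ʳ = here ; agree→ = λ () ; agree← = λ () })
⊆⇒≡⊎≺ {X = outside ∷ X} {outside ∷ Y} X⊆Y with ⊆⇒≡⊎≺ (drop-∷-⊆ X⊆Y)
... | inj₁ X≡Y     = inj₁ (cong (outside ∷_) X≡Y)
... | inj₂ (i , d) = inj₂ (suc i , differ-suc outside d)
⊆⇒≡⊎≺ {X = inside ∷ X}  {inside ∷ Y}  X⊆Y with ⊆⇒≡⊎≺ (drop-∷-⊆ X⊆Y)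
... | inj₁ X≡Y     = inj₁ (cong (inside ∷_) X≡Y)
... | inj₂ (i , d) = inj₂ (suc i , differ-suc inside d)

differ-≺ : ∀ {i j} {X Y Z : Subset n} → Differ i X Y → Differ j Y Z → X ≺ Z
differ-≺ {i = i} {j} {X} {Y} {Z} d e with <-cmp (toℕ i) (toℕ j)
... | tri< i<j _ _ = i , record
  { ∉ˡ     = ∉ˡ d
  ; ∈ʳ     = agree→ e i<j (∈ʳ d)
  ; agree→ = λ l<i → agree→ e (<-trans l<i i<j) ∘ agree→ d l<i
  ; agree← = λ l<i → agree← d l<i ∘ agree← e (<-trans l<i i<j)
  }
... | tri≈ _ i≡j _ = contradiction (subst (_∈ Y) (toℕ-injective i≡j) (∈ʳ d)) (∉ˡ e)
... | tri> _ _ j<i = j , record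
  { ∉ˡ     = ∉ˡ e ∘ agree→ d j<i
  ; ∈ʳ     = ∈ʳ e
  ; agree→ = λ l<j → agree→ e l<j ∘ agree→ d (<-trans l<j j<i)
  ; agree← = λ l<j → agree← d (<-trans l<j j<i) ∘ agree← e l<j
  }

differ-between : ∀ {i j} {X Y Z : Subset n} → i <ᶠ j → Differ i X Z → Differ j Y Z → Differ i X Y
differ-between i<j d e = record
  { ∉ˡ     = ∉ˡ d
  ; ∈ʳ     = agree← e i<j (∈ʳ d)
  ; agree→ = λ l<i → agree← e (<-trans l<i i<j) ∘ agree→ d l<i
  ; agree← = λ l<i → agree← d l<i ∘ agree→ e (<-trans l<i i<j)
  }

-- The successor of an implicate set

module _ (p : B → Bool) (q : B → A) where

  keepLast : Maybe A → B → Maybe A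
  keepLast r b = ifᵇ p b then just (q b) else r

  -- Later successes overwrite earlier ones, so a full pass without early exit finds the largest
  -- index. The function `φ` makes the statement inductive, since the tail of `allFin` is no
  -- `allFin`.
  foldl-keepLast : ∀ {m} (φ : Fin m → B) r →
    (foldl keepLast r (tabulate φ) ≡ r × (∀ i → ¬ T (p (φ i)))) ⊎
    (∃ λ i → foldl keepLast r (tabulate φ) ≡ just (q (φ i)) × T (p (φ i)) ×
             (∀ j → i <ᶠ j → ¬ T (p (φ j))))
  foldl-keepLast {zero}  φ r = inj₁ (refl , λ ())
  foldl-keepLast {suc m} φ r with foldl-keepLast (φ ∘ suc) (keepLast r (φ zero))
  ... | inj₂ (i , eq , pi , last) =
    inj₂ (suc i , eq , pi , λ where (suc j) (s≤s i<j) → last j i<j)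
  ... | inj₁ (eq , none) with p (φ zero) in p₀
  ...   | true  = inj₂ (zero , eq , subst T (sym p₀) _ , λ where (suc j) _ → none j)
  ...   | false = inj₁ (eq , λ where
                    zero    → subst T p₀
                    (suc i) → none i)

module _ {n : ℕ} (Ψ : CNF n) (S : Subset n) where

  candidate : Fin n → Subset n
  candidate i = interior Ψ ((S ─ upper (toℕ i)) ∪ upper (suc (toℕ i)))

  admissible : Fin n → Bool
  admissible i = does (upper (toℕ i) ─ upper (suc (toℕ i)) ⊆? S) ∧
                 does (S ─ upper (toℕ i) ⊆? candidate i)

  successor : Maybe (Subset n)
  successor = foldl (keepLast admissible candidate) nothing (allFin n)

  admissible⁻ : ∀ i → T (admissible i) → i ∈ S × S ─ upper (toℕ i) ⊆ candidate i
  admissible⁻ i t with upper (toℕ i) ─ upper (suc (toℕ i)) ⊆? S | S ─ upper (toℕ i) ⊆? candidate i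
  ... | yes i⊆S | yes prefix⊆ =
    i⊆S (x∈p∧x∉q⇒x∈p─q (∈-upper⁺ (toℕ i) ≤-refl) (<-irrefl refl ∘ ∈-upper⁻ (suc (toℕ i)))) , prefix⊆

  admissible⁺ : ∀ i → i ∈ S → S ─ upper (toℕ i) ⊆ candidate i → T (admissible i)
  admissible⁺ i i∈S prefix⊆
    with upper (toℕ i) ─ upper (suc (toℕ i)) ⊆? S | S ─ upper (toℕ i) ⊆? candidate i
  ... | yes _   | yes _ = _
  ... | yes _   | no  ⊈ = contradiction (λ {x} → prefix⊆ {x}) ⊈
  ... | no  i⊈S | _     = contradiction (λ {x} → i⊆S {x}) i⊈S
    where
    i⊆S : upper (toℕ i) ─ upper (suc (toℕ i)) ⊆ S
    i⊆S {j} j∈ with m≤n⇒m<n∨m≡n (∈-upper⁻ (toℕ i) (p─q⊆p _ (upper (suc (toℕ i))) j∈))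
    ... | inj₁ i<j = contradiction (∈-upper⁺ (suc (toℕ i)) i<j)
                                   (x∈p─q⇒x∉q (upper (toℕ i)) (upper (suc (toℕ i))) j∈)
    ... | inj₂ i≡j = subst (_∈ S) (toℕ-injective i≡j) i∈S

  prefix⁺ : ∀ {i j : Fin n} → j <ᶠ i → j ∈ S → j ∈ S ─ upper (toℕ i)
  prefix⁺ {i} j<i j∈S = x∈p∧x∉q⇒x∈p─q j∈S (<⇒≱ j<i ∘ ∈-upper⁻ (toℕ i))

  candidate⁻ : ∀ {i j : Fin n} → j ∈ candidate i → j ∈ S × j <ᶠ i ⊎ i <ᶠ j
  candidate⁻ {i} {j} j∈ with x∈p∪q⁻ (S ─ upper (toℕ i)) _ (interior-⊆ Ψ _ j∈)
  ... | inj₂ j∈upper  = inj₂ (∈-upper⁻ (suc (toℕ i)) j∈upper)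
  ... | inj₁ j∈prefix =
    inj₁ (p─q⊆p S _ j∈prefix ,
          ≰⇒> (x∈p─q⇒x∉q S (upper (toℕ i)) j∈prefix ∘ ∈-upper⁺ (toℕ i)))

  candidate-differ : ∀ i → T (admissible i) → Differ i (candidate i) S
  candidate-differ i t = record
    { ∉ˡ     = λ i∈ → bad (candidate⁻ i∈)
    ; ∈ʳ     = proj₁ (admissible⁻ i t)
    ; agree→ = λ j<i j∈ → good j<i (candidate⁻ j∈)
    ; agree← = λ j<i j∈S → proj₂ (admissible⁻ i t) (prefix⁺ j<i j∈S)
    }
    where
    bad : ¬ (i ∈ S × i <ᶠ i ⊎ i <ᶠ i)
    bad (inj₁ (_ , i<i)) = <-irrefl refl i<i
    bad (inj₂ i<i)       = <-irrefl refl i<i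
    good : ∀ {j} → j <ᶠ i → j ∈ S × j <ᶠ i ⊎ i <ᶠ j → j ∈ S
    good j<i (inj₁ (j∈S , _)) = j∈S
    good j<i (inj₂ i<j)       = contradiction i<j (<-asym j<i)

  differ⇒⊆candidate : ∀ {i I} → SelfSupporting Ψ I → Differ i I S → I ⊆ candidate i
  differ⇒⊆candidate {i} {I} sup d = interior-greatest Ψ sup (λ {j} → below j)
    where
    below : ∀ j → j ∈ I → j ∈ (S ─ upper (toℕ i)) ∪ upper (suc (toℕ i))
    below j j∈I with <-cmp (toℕ j) (toℕ i)
    ... | tri< j<i _ _ = x∈p∪q⁺ (inj₁ (prefix⁺ j<i (agree→ d j<i j∈I)))
    ... | tri≈ _ j≡i _ = contradiction (subst (_∈ I) (toℕ-injective j≡i) j∈I) (∉ˡ d)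
    ... | tri> _ _ i<j = x∈p∪q⁺ (inj₂ (∈-upper⁺ (suc (toℕ i)) i<j))

  -- The candidate contains `I`, and `I` contains the prefix of `S` below `i`.
  differ⇒admissible : ∀ {i I} → SelfSupporting Ψ I → Differ i I S → T (admissible i)
  differ⇒admissible {i} {I} sup d = admissible⁺ i (∈ʳ d) λ j∈ →
    differ⇒⊆candidate sup d (agree← d (≰⇒> (x∈p─q⇒x∉q S (upper (toℕ i)) j∈ ∘ ∈-upper⁺ (toℕ i)))
                                    (p─q⊆p S _ j∈))

  -- The list is decreasing, so `I ≺ S` means that `I` is output after `S`.
  data Successor : Maybe (Subset n) → Set where
    last : (∀ {I} → SelfSupporting Ψ I → ¬ I ≺ S) → Successor nothing
    next : ∀ {S′} → SelfSupporting Ψ S′ → S′ ≺ S →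
           (∀ {I} → SelfSupporting Ψ I → I ≺ S → I ≡ S′ ⊎ I ≺ S′) → Successor (just S′)

  successor-correct : Successor successor
  successor-correct with foldl-keepLast admissible candidate (λ i → i) nothing
  ... | inj₁ (eq , none) =
    subst Successor (sym eq) (last λ sup (i , d) → none i (differ⇒admissible sup d))
  ... | inj₂ (i , eq , adm , maximal) =
    subst Successor (sym eq)
      (next (interior-selfSupporting Ψ _) (i , candidate-differ i adm) between)
    where
    between : ∀ {I} → SelfSupporting Ψ I → I ≺ S → I ≡ candidate i ⊎ I ≺ candidate i
    between sup (j , d) with <-cmp (toℕ j) (toℕ i)
    -- A set that leaves `S` before `i` is below the candidate; leaving it after `i` contradicts the
    -- maximality of `i`; at `i` itself the set is included in the candidate, and inclusion implies
    -- the order.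
    ... | tri< j<i _ _ = inj₂ (j , differ-between j<i d (candidate-differ i adm))
    ... | tri> _ _ i<j = contradiction (differ⇒admissible sup d) (maximal j i<j)
    ... | tri≈ _ j≡i _ =
      ⊆⇒≡⊎≺ (subst (λ l → _ ⊆ candidate l) (toℕ-injective j≡i) (differ⇒⊆candidate sup d))

-- Polynomials and programs

infixl 6 _⊕_
_⊕_ : Polynomial → Polynomial → Polynomial
[]      ⊕ q       = q
(a ∷ p) ⊕ []      = a ∷ p
(a ∷ p) ⊕ (b ∷ q) = (a + b) ∷ (p ⊕ q)

⊕-at : ∀ p q x → (p ⊕ q) at x ≡ p at x + q at x
⊕-at []      q       x = refl
⊕-at (a ∷ p) []      x = sym (+-identityʳ _)
⊕-at (a ∷ p) (b ∷ q) x = begin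
  (a + b) + x * ((p ⊕ q) at x)              ≡⟨ cong (λ y → (a + b) + x * y) (⊕-at p q x) ⟩
  (a + b) + x * (p at x + q at x)           ≡⟨ cong ((a + b) +_) (*-distribˡ-+ x (p at x) (q at x)) ⟩
  (a + b) + (x * (p at x) + x * (q at x))   ≡⟨ +-assoc a b _ ⟩
  a + (b + (x * (p at x) + x * (q at x)))   ≡⟨ cong (a +_) (x+[y+z]≡y+[x+z] b (x * (p at x)) (x * (q at x))) ⟩
  a + (x * (p at x) + (b + x * (q at x)))   ≡⟨ +-assoc a _ _ ⟨
  (a + x * (p at x)) + (b + x * (q at x))   ∎
  where
  open ≡-Reasoning
  x+[y+z]≡y+[x+z] : ∀ x y z → x + (y + z) ≡ y + (x + z)
  x+[y+z]≡y+[x+z] x y z = trans (sym (+-assoc x y z)) (trans (cong (_+ z) (+-comm x y)) (+-assoc y x z))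

constant-at : ∀ a x → [ a ] at x ≡ a
constant-at a x = trans (cong (a +_) (*-zeroʳ x)) (+-identityʳ a)

-- A first-order functional language

-- A fold runs along one of the two lists of the input, never along a computed tree. This makes it
-- possible to define `bound` by recursion on the syntax.
data Source : Set where
  variables clauses : Source

-- In the body of a fold, variable 0 is the remaining input list, whose
-- head is the current element, and variable 1 is the accumulator.
data Term (k : ℕ) : Set where
  ret  : Expr k → Term k
  bind : Term k → Term (suc k) → Term k
  cond : Expr k → Term k → Term k → Term k
  fold : Source → Expr k → Term (suc (suc k)) → Term k

branch : Tree → Tree → Tree → Tree
branch nil     s t = t
branch (_ ∙ _) s t = s

source : Source → Tree → Tree
source variables = head′
source clauses   = tail′

foldTree : (Tree → Tree → Tree) → Tree → Tree → Tree
foldTree f nil     a = a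
foldTree f (l ∙ r) a = foldTree f r (f (l ∙ r) a)

⟦_⟧ᵗ : Term k → Tree → Store k → Tree
⟦ ret e      ⟧ᵗ I ρ = eval e ρ
⟦ bind s t   ⟧ᵗ I ρ = ⟦ t ⟧ᵗ I (⟦ s ⟧ᵗ I ρ ∷ ρ)
⟦ cond e s t ⟧ᵗ I ρ = branch (eval e ρ) (⟦ s ⟧ᵗ I ρ) (⟦ t ⟧ᵗ I ρ)
⟦ fold s e t ⟧ᵗ I ρ = foldTree (λ c a → ⟦ t ⟧ᵗ I (c ∷ a ∷ ρ)) (source s I) (eval e ρ)

-- Compilation to a stack machine: variable 0 holds the input and
-- variable 1 holds the environment as a list.

stack : Store k → Tree
stack []      = nil
stack (x ∷ ρ) = x ∙ stack ρ

config : Tree → Store k → Store 2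
config I ρ = I ∷ stack ρ ∷ []

stackReg : Fin 2
stackReg = suc zero

pattern W = var (suc zero)

tails : ℕ → Expr 2
tails zero    = W
tails (suc j) = tl (tails j)

place : Expr k → Expr 2
place (var x)    = hd (tails (toℕ x))
place nil        = nil
place (cons e f) = cons (place e) (place f)
place (hd e)     = hd (place e)
place (tl e)     = tl (place e)

eval-tails : ∀ j I t u → eval (tails (suc j)) (I ∷ (t ∙ u) ∷ []) ≡ eval (tails j) (I ∷ u ∷ [])
eval-tails zero    I t u = refl
eval-tails (suc j) I t u = cong tail′ (eval-tails j I t u)

eval-var : ∀ (x : Fin k) I ρ → eval (hd (tails (toℕ x))) (config I ρ) ≡ lookup ρ x
eval-var zero    I (t ∷ ρ) = refl
eval-var (suc x) I (t ∷ ρ) =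
  trans (cong head′ (eval-tails (toℕ x) I t (stack ρ))) (eval-var x I ρ)

eval-place : ∀ (e : Expr k) I ρ → eval (place e) (config I ρ) ≡ eval e ρ
eval-place (var x)    I ρ = eval-var x I ρ
eval-place nil        I ρ = refl
eval-place (cons e f) I ρ = cong₂ _∙_ (eval-place e I ρ) (eval-place f I ρ)
eval-place (hd e)     I ρ = cong head′ (eval-place e I ρ)
eval-place (tl e)     I ρ = cong tail′ (eval-place e I ρ)

push : Expr 2 → Cmd 2
push e = stackReg := cons e W

popSecond : Expr 2
popSecond = cons (hd W) (tl (tl W))

-- After the loop body the stack holds the new accumulator, the remaining list, the old accumulator
-- and the environment. The list loses its head and the old accumulator is dropped.
advance : Expr 2
advance = cons (tl (hd (tl W))) (cons (hd W) (tl (tl (tl W))))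

sourceExpr : Source → Expr 2
sourceExpr variables = hd (var zero)
sourceExpr clauses   = tl (var zero)

compile : Term k → Cmd 2
compile (ret e)      = push (place e)
compile (bind s t)   = compile s ⨾ compile t ⨾ stackReg := popSecond
compile (cond e s t) = if place e then compile s else compile t
compile (fold s e t) =
  push (place e) ⨾
  push (sourceExpr s) ⨾
  (while hd W loop (compile t ⨾ stackReg := advance)) ⨾
  stackReg := tl W

-- A conditional is charged for both branches, since a sum of polynomials is again one. In a fold,
-- `0 ∷_` multiplies by the input size, which bounds the number of rounds; each round pays 3 for the
-- loop test, and 6 covers the failing test and the final pop.
bound : Term k → Polynomial
bound (ret e)      = [ suc (cost (cons (place e) W)) ]
bound (bind s t)   = bound s ⊕ (bound t ⊕ [ suc (cost popSecond) ])
bound (cond e s t) = [ suc (cost (place e)) ] ⊕ (bound s ⊕ bound t)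
bound (fold s e t) =
  [ suc (cost (cons (place e) W)) + (suc (cost (cons (sourceExpr s) W)) + 6) ] ⊕
  (0 ∷ ([ 3 + suc (cost advance) ] ⊕ bound t))

-- Runs without output and their time

ticks-++ : ∀ s t → ticks s ++ ticks t ≡ ticks (s + t)
ticks-++ zero    t = refl
ticks-++ (suc s) t = cong (tick ∷_) (ticks-++ s t)

retrace : ∀ {c : Cmd k} {σ σ′ τ τ′} → τ ≡ τ′ → ⟨ c , σ ⟩⇓⟨ τ , σ′ ⟩ → ⟨ c , σ ⟩⇓⟨ τ′ , σ′ ⟩
retrace refl r = r

Silent : Cmd k → Store k → Store k → ℕ → Set
Silent c σ σ′ b = ∃ λ t → t ≤ b × ⟨ c , σ ⟩⇓⟨ ticks t , σ′ ⟩

silent-≤ : ∀ {c : Cmd k} {σ σ′ a b} → a ≤ b → Silent c σ σ′ a → Silent c σ σ′ b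
silent-≤ a≤b (t , t≤a , r) = t , ≤-trans t≤a a≤b , r

silent-assign : ∀ {x : Fin k} {e σ v} → eval e σ ≡ v → Silent (x := e) σ (σ [ x ]≔ v) (suc (cost e))
silent-assign refl = _ , ≤-refl , ⇓-assign

silent-seq : ∀ {c d : Cmd k} {σ σ′ σ″ a b} →
             Silent c σ σ′ a → Silent d σ′ σ″ b → Silent (c ⨾ d) σ σ″ (a + b)
silent-seq (s , s≤a , r) (t , t≤b , r′) =
  s + t , +-mono-≤ s≤a t≤b ,
  retrace (ticks-++ s t) (⇓-seq r r′)

silent-if : ∀ {e} {c d : Cmd k} {σ x y a b} {F : Tree → Store k} →
            Silent c σ (F x) a → Silent d σ (F y) b →
            Silent (if e then c else d) σ (F (branch (eval e σ) x y)) (suc (cost e) + (a + b))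
silent-if {e = e} {σ = σ} {a = a} {b} (s , s≤a , r) (t , t≤b , r′) with eval e σ in eq
... | nil   = suc (cost e) + t , +-monoʳ-≤ (suc (cost e)) (≤-trans t≤b (m≤n+m b a)) ,
              retrace (ticks-++ (suc (cost e)) t) (⇓-if-false eq r′)
... | _ ∙ _ = suc (cost e) + s , +-monoʳ-≤ (suc (cost e)) (≤-trans s≤a (m≤m+n a b)) ,
              retrace (ticks-++ (suc (cost e)) s)
                (⇓-if-true (λ eq′ → case trans (sym eq) eq′ of λ ()) r)

spine : Tree → ℕ
spine nil     = 0
spine (l ∙ r) = suc (spine r)

spine≤size : ∀ t → spine t ≤ size t
spine≤size nil     = z≤n
spine≤size (l ∙ r) = s≤s (≤-trans (spine≤size r) (m≤n+m (size r) (size l)))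

spine-source : ∀ s I → spine (source s I) ≤ size I
spine-source variables nil     = z≤n
spine-source variables (l ∙ r) =
  m≤n⇒m≤1+n (≤-trans (spine≤size l) (m≤m+n (size l) (size r)))
spine-source clauses   nil     = z≤n
spine-source clauses   (l ∙ r) =
  m≤n⇒m≤1+n (≤-trans (spine≤size r) (m≤n+m (size r) (size l)))

silent-while : ∀ {c} {I} {ρ : Store k} {b} (f : Tree → Tree → Tree) →
  (∀ u a → Silent c (config I (u ∷ a ∷ ρ)) (config I (tail′ u ∷ f u a ∷ ρ)) b) →
  ∀ u a → Silent (while hd W loop c) (config I (u ∷ a ∷ ρ)) (config I (nil ∷ foldTree f u a ∷ ρ))
                 (3 + spine u * (3 + b))
silent-while f step nil a = 3 , ≤-refl , ⇓-while-false refl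
silent-while {b = b} f step (l ∙ r) a with step (l ∙ r) a | silent-while f step r (f (l ∙ r) a)
... | s , s≤b , p | t , t≤ , q =
  3 + (s + t) , le ,
  retrace
    (trans (cong (ticks 3 ++_) (ticks-++ s t)) (ticks-++ 3 (s + t)))
    (⇓-while-true (λ ()) p q)
  where
  open ≤-Reasoning
  le : 3 + (s + t) ≤ 3 + (3 + b + spine r * (3 + b))
  le = +-monoʳ-≤ 3 (begin
    s + t                              ≤⟨ +-mono-≤ s≤b t≤ ⟩
    b + (3 + spine r * (3 + b))        ≡⟨ +-assoc b 3 _ ⟨
    b + 3 + spine r * (3 + b)          ≡⟨ cong (_+ spine r * (3 + b)) (+-comm b 3) ⟩
    3 + b + spine r * (3 + b)          ∎)

-- The bound does not mention `ρ`: an expression costs the same on trees of any size.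
compile-correct : ∀ (t : Term k) I ρ →
  Silent (compile t) (config I ρ) (config I (⟦ t ⟧ᵗ I ρ ∷ ρ)) (bound t at size I)
compile-correct (ret e) I ρ =
  silent-≤ (≤-reflexive (sym (constant-at _ (size I))))
    (silent-assign (cong (_∙ stack ρ) (eval-place e I ρ)))
compile-correct (bind s t) I ρ =
  silent-≤ (≤-reflexive (sym eq))
    (silent-seq (compile-correct s I ρ)
      (silent-seq (compile-correct t I _) (silent-assign refl)))
  where
  x = size I
  eq : bound (bind s t) at x ≡ bound s at x + (bound t at x + suc (cost popSecond))
  eq = trans (⊕-at (bound s) _ x)
         (cong (bound s at x +_) (trans (⊕-at (bound t) _ x)
           (cong (bound t at x +_) (constant-at _ x))))
compile-correct (cond e s t) I ρ =
  silent-≤ (≤-reflexive (sym eq))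
    (subst (λ v → Silent _ _ (config I (branch v _ _ ∷ ρ)) _) (eval-place e I ρ)
      (silent-if {e = place e} {F = λ v → config I (v ∷ ρ)} (compile-correct s I ρ) (compile-correct t I ρ)))
  where
  x = size I
  eq : bound (cond e s t) at x ≡ suc (cost (place e)) + (bound s at x + bound t at x)
  eq = trans (⊕-at [ suc (cost (place e)) ] (bound s ⊕ bound t) x)
         (cong₂ _+_ (constant-at _ x) (⊕-at (bound s) (bound t) x))
compile-correct (fold s e t) I ρ =
  silent-≤ le
    (silent-seq (silent-assign (cong (_∙ stack ρ) (eval-place e I ρ)))
      (silent-seq (silent-assign (cong (_∙ _) (sourceExpr-correct s)))
        (silent-seq
          (silent-while (λ u a → ⟦ t ⟧ᵗ I (u ∷ a ∷ ρ))
            (λ u a → silent-seq (compile-correct t I (u ∷ a ∷ ρ)) (silent-assign refl))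
            (source s I) (eval e ρ))
          (silent-assign refl))))
  where
  x = size I
  d = suc (cost advance)
  b = bound t at x
  c₁ = suc (cost (cons (place e) W))
  c₂ = suc (cost (cons (sourceExpr s) W))
  sourceExpr-correct : ∀ s {u} → eval (sourceExpr s) (I ∷ u ∷ []) ≡ source s I
  sourceExpr-correct variables = refl
  sourceExpr-correct clauses   = refl
  L = spine (source s I)
  open ≤-Reasoning
  step : 3 + (b + d) ≡ ([ 3 + d ] ⊕ bound t) at x
  step = trans (cong (3 +_) (+-comm b d))
           (trans (cong (_+ b) (sym (constant-at (3 + d) x))) (sym (⊕-at [ 3 + d ] (bound t) x)))
  le : c₁ + (c₂ + ((3 + L * (3 + (b + d))) + 3)) ≤ bound (fold s e t) at x
  le = begin
    c₁ + (c₂ + ((3 + L * (3 + (b + d))) + 3))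
      ≡⟨ cong (λ y → c₁ + (c₂ + y)) (trans (+-comm _ 3) (sym (+-assoc 3 3 (L * (3 + (b + d)))))) ⟩
    c₁ + (c₂ + (6 + L * (3 + (b + d))))
      ≡⟨ cong (c₁ +_) (+-assoc c₂ 6 _) ⟨
    c₁ + (c₂ + 6 + L * (3 + (b + d)))
      ≡⟨ +-assoc c₁ (c₂ + 6) _ ⟨
    c₁ + (c₂ + 6) + L * (3 + (b + d))
      ≤⟨ +-monoʳ-≤ (c₁ + (c₂ + 6)) (*-mono-≤ (spine-source s I) (≤-reflexive step)) ⟩
    c₁ + (c₂ + 6) + x * (([ 3 + d ] ⊕ bound t) at x)
      ≡⟨ cong (_+ x * (([ 3 + d ] ⊕ bound t) at x)) (constant-at (c₁ + (c₂ + 6)) x) ⟨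
    [ c₁ + (c₂ + 6) ] at x + x * (([ 3 + d ] ⊕ bound t) at x)
      ≡⟨ ⊕-at [ c₁ + (c₂ + 6) ] (0 ∷ ([ 3 + d ] ⊕ bound t)) x ⟨
    bound (fold s e t) at x ∎

-- The program

pattern x₀ = var zero
pattern x₁ = var (suc zero)
pattern x₂ = var (suc (suc zero))
pattern x₃ = var (suc (suc (suc zero)))
pattern x₄ = var (suc (suc (suc (suc zero))))
pattern x₅ = var (suc (suc (suc (suc (suc zero)))))
pattern x₆ = var (suc (suc (suc (suc (suc (suc zero))))))

one : Expr k
one = cons nil nil

-- The accumulator of a traversal is e ∙ a ∙ b ∙ c, where e is the result so far
-- and a, b and c are the unread parts of three sets.
firstᵗ secondᵗ thirdᵗ : Expr (suc (suc k))
firstᵗ  = hd (tl x₁)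
secondᵗ = hd (tl (tl x₁))
thirdᵗ  = tl (tl (tl x₁))

proceed : Expr (suc (suc k)) → Term (suc (suc k))
proceed e = ret (cons e (cons (tl firstᵗ) (cons (tl secondᵗ) (tl thirdᵗ))))

-- The list of variables is only a clock; the three sets are read in step with it.
traverse : Expr k → Expr k → Expr k → Expr k → Term (suc (suc k)) → Term k
traverse e a b c = fold variables (cons e (cons a (cons b c)))

subsetStep : Term (suc (suc k))
subsetStep =
  cond (hd firstᵗ)
    (cond (hd secondᵗ) (proceed (hd x₁)) (cond (hd thirdᵗ) (proceed (hd x₁)) (proceed nil)))
    (proceed (hd x₁))

-- Every test of the algorithm has the form `a ─ b ⊆ c`; `nil` stands for the empty set.
─⊆ᵗ : Expr k → Expr k → Expr k → Term k
─⊆ᵗ a b c = bind (traverse one a b c subsetStep) (ret (hd x₀))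

mergeStep : Term (suc (suc k))
mergeStep =
  cond (hd thirdᵗ) (proceed (cons one (hd x₁)))
    (cond (hd secondᵗ) (proceed (cons nil (hd x₁)))
      (cond (hd firstᵗ) (proceed (cons one (hd x₁))) (proceed (cons nil (hd x₁)))))

reverseStep : Term (suc (suc k))
reverseStep = ret (cons (tl (hd x₁)) (cons (hd (hd x₁)) (tl x₁)))

─∪ᵗ : Expr k → Expr k → Expr k → Term k
─∪ᵗ a b c =
  bind (traverse nil a b c mergeStep)
    -- Merging conses the bits in reverse order; a second pass restores it.
    (bind (fold variables (cons (hd x₀) nil) reverseStep) (ret (tl x₀)))

fireᵗ : Term (suc (suc k))
fireᵗ =
  bind (─⊆ᵗ (hd (hd x₀)) nil x₁)
    (cond x₀ (─∪ᵗ x₂ nil (tl (hd x₁))) (ret x₂))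

closureᵗ : Expr k → Term k
closureᵗ e = fold variables e (fold clauses x₁ fireᵗ)

-- The second component of the accumulator is the incidence vector of the
-- element under consideration, cut off after that element.
pruneᵗ : Term (suc (suc k))
pruneᵗ =
  bind (─∪ᵗ (hd x₁) (tl x₁) nil)
    (bind (closureᵗ x₀)
      (bind (─⊆ᵗ (tl x₃) nil x₀)
        (cond x₀ (ret (cons (hd x₄) (cons nil (tl x₄))))
                 (ret (cons x₂ (cons nil (tl x₄)))))))

interiorᵗ : Expr k → Term k
interiorᵗ e =
  fold variables e
    (bind (fold variables (cons x₁ (cons one nil)) pruneᵗ) (ret (hd x₀)))

fullᵗ : Term k
fullᵗ = fold variables nil (ret (cons one x₁))

firstSet : Term 0
firstSet = bind fullᵗ (bind (interiorᵗ x₀) (ret (cons x₀ nil)))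

-- The second component of the accumulator is the incidence vector of [i,n).
keepLastᵗ : Term 4
keepLastᵗ =
  -- Consing `nil` moves a vector up by one: `cons nil (tl x₁)` stands for `[i+1,n)`.
  bind (─⊆ᵗ (tl x₁) (cons nil (tl x₁)) (hd x₃))
    (bind (─∪ᵗ (hd x₄) (tl x₂) (cons nil (tl x₂)))
      (bind (interiorᵗ x₀)
        (bind (─⊆ᵗ (hd x₆) (tl x₄) x₀)
          (cond x₃
            (cond x₀ (ret (cons (cons x₁ nil) (cons nil (tl x₅))))
                     (ret (cons (hd x₅) (cons nil (tl x₅)))))
            (ret (cons (hd x₅) (cons nil (tl x₅))))))))

nextSet : Term 1
nextSet =
  bind fullᵗ
    (bind (fold variables (cons nil x₀) keepLastᵗ) (ret (hd x₀)))

-- Correctness of the program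

-- A record, so that t, ρ and v can be inferred although ⟦_⟧ᵗ computes.
infix 4 _⊢_,_↓_
record _⊢_,_↓_ (I : Tree) (t : Term k) (ρ : Store k) (v : Tree) : Set where
  constructor evaluates
  field
    value≡ : ⟦ t ⟧ᵗ I ρ ≡ v

open _⊢_,_↓_

private
  variable
    I u v w : Tree
    ρ : Store k
    e : Expr k
    s t : Term k

↓-ret : eval e ρ ≡ v → I ⊢ ret e , ρ ↓ v
↓-ret = evaluates

↓-bind : I ⊢ s , ρ ↓ u → I ⊢ t , u ∷ ρ ↓ v → I ⊢ bind s t , ρ ↓ v
↓-bind {I = I} {ρ = ρ} {t = t} (evaluates p) (evaluates q) =
  evaluates (trans (cong (λ w → ⟦ t ⟧ᵗ I (w ∷ ρ)) p) q)

↓-cond : ∀ b → eval e ρ ≡ boolTree b → I ⊢ s , ρ ↓ u → I ⊢ t , ρ ↓ v →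
         I ⊢ cond e s t , ρ ↓ (ifᵇ b then u else v)
↓-cond {I = I} {s = s} {t = t} true  eq (evaluates p) q =
  evaluates (trans (cong (λ w → branch w (⟦ s ⟧ᵗ I _) (⟦ t ⟧ᵗ I _)) eq) p)
↓-cond {I = I} {s = s} {t = t} false eq p (evaluates q) =
  evaluates (trans (cong (λ w → branch w (⟦ s ⟧ᵗ I _) (⟦ t ⟧ᵗ I _)) eq) q)

≡-↓ : v ≡ w → I ⊢ t , ρ ↓ v → I ⊢ t , ρ ↓ w
≡-↓ refl p = p

evaluates⇒silent : I ⊢ t , ρ ↓ v →
                   Silent (compile t) (config I ρ) (config I (v ∷ ρ)) (bound t at size I)
evaluates⇒silent {I = I} {t = t} {ρ} (evaluates refl) = compile-correct t I ρ

truth : Tree → Bool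
truth nil     = false
truth (_ ∙ _) = true

-- Trees are read as incidence vectors padded with zeros.
bits : ∀ n → Tree → Subset n
bits zero    t = []
bits (suc n) t = truth (head′ t) ∷ bits n (tail′ t)

bits-subsetTree : ∀ (X : Subset n) → bits n (subsetTree X) ≡ X
bits-subsetTree []            = refl
bits-subsetTree (outside ∷ X) = cong (outside ∷_) (bits-subsetTree X)
bits-subsetTree (inside  ∷ X) = cong (inside ∷_) (bits-subsetTree X)

bits-nil : ∀ n → bits n nil ≡ ⊥
bits-nil zero    = refl
bits-nil (suc n) = cong (outside ∷_) (bits-nil n)

counter : ℕ → Tree
counter m = listTree (replicate m nil)

subsetStep-correct : ∀ I (ρ : Store k) m e a b c →
  head′ (foldTree (λ c a → ⟦ subsetStep ⟧ᵗ I (c ∷ a ∷ ρ)) (counter m) (e ∙ a ∙ b ∙ c)) ≡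
  (ifᵇ does (bits m a ─ bits m b ⊆? bits m c) then e else nil)
subsetStep-correct I ρ zero    e a b c = refl
subsetStep-correct I ρ (suc m) e a b c with head′ a | head′ b | head′ c
... | nil   | nil   | _     = subsetStep-correct I ρ m e _ _ _
... | nil   | _ ∙ _ | _     = subsetStep-correct I ρ m e _ _ _
... | _ ∙ _ | _ ∙ _ | _     = subsetStep-correct I ρ m e _ _ _
... | _ ∙ _ | nil   | _ ∙ _ = subsetStep-correct I ρ m e _ _ _
-- After a failure the result is `nil` whatever the rest of the traversal finds. This is why the
-- statement allows any `e`.
... | _ ∙ _ | nil   | nil   =
  trans (subsetStep-correct I ρ m nil (tail′ a) (tail′ b) (tail′ c)) (if-eta _)

mergeStep-correct : ∀ I (ρ : Store k) m os a b c →
  head′ (foldTree (λ c a → ⟦ mergeStep ⟧ᵗ I (c ∷ a ∷ ρ)) (counter m) (listTree os ∙ a ∙ b ∙ c)) ≡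
  listTree (map boolTree (toList ((bits m a ─ bits m b) ∪ bits m c)) ʳ++ os)
mergeStep-correct I ρ zero    os a b c = refl
mergeStep-correct I ρ (suc m) os a b c with head′ a | head′ b | head′ c
... | nil   | nil   | nil   = mergeStep-correct I ρ m (nil ∷ os) _ _ _
... | nil   | nil   | _ ∙ _ = mergeStep-correct I ρ m ((nil ∙ nil) ∷ os) _ _ _
... | nil   | _ ∙ _ | nil   = mergeStep-correct I ρ m (nil ∷ os) _ _ _
... | nil   | _ ∙ _ | _ ∙ _ = mergeStep-correct I ρ m ((nil ∙ nil) ∷ os) _ _ _
... | _ ∙ _ | nil   | nil   = mergeStep-correct I ρ m ((nil ∙ nil) ∷ os) _ _ _
... | _ ∙ _ | nil   | _ ∙ _ = mergeStep-correct I ρ m ((nil ∙ nil) ∷ os) _ _ _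
... | _ ∙ _ | _ ∙ _ | nil   = mergeStep-correct I ρ m (nil ∷ os) _ _ _
... | _ ∙ _ | _ ∙ _ | _ ∙ _ = mergeStep-correct I ρ m ((nil ∙ nil) ∷ os) _ _ _

reverseStep-correct : ∀ I (ρ : Store k) xs ys →
  foldTree (λ c a → ⟦ reverseStep ⟧ᵗ I (c ∷ a ∷ ρ)) (counter (length xs)) (listTree xs ∙ listTree ys) ≡
  nil ∙ listTree (xs ʳ++ ys)
reverseStep-correct I ρ []       ys = refl
reverseStep-correct I ρ (x ∷ xs) ys = reverseStep-correct I ρ xs (x ∷ ys)

-- Starting from a single one this is the singleton of `i`, starting from all ones the set `[i,n)`.
-- Entries pushed beyond `n` are ignored by `bits`.
shift : ℕ → Tree → Tree
shift zero    g = g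
shift (suc i) g = nil ∙ shift i g

foldTree-rounds : ∀ {f : Tree → Tree → Tree} (F : A → Tree) {h : A → A} →
  (∀ u x → f u (F x) ≡ F (h x)) → ∀ m x → foldTree f (counter m) (F x) ≡ F (repeat m h x)
foldTree-rounds F step zero    x = refl
foldTree-rounds {f = f} F step (suc m) x =
  trans (cong (foldTree f (counter m)) (step _ x)) (foldTree-rounds F step m _)

foldTree-clauses : ∀ {f : Tree → Tree → Tree} (F : A → Tree) {h : A → Clause n → A} →
  (∀ C u x → f (clauseTree C ∙ u) (F x) ≡ F (h x C)) →
  ∀ Φ x → foldTree f (listTree (map clauseTree Φ)) (F x) ≡ F (foldl h x Φ)
foldTree-clauses F step []      x = refl
foldTree-clauses {f = f} F step (C ∷ Φ) x =
  trans (cong (foldTree f (listTree (map clauseTree Φ))) (step C _ x)) (foldTree-clauses F step Φ _)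

-- The offset `j` and the map `φ` describe a final segment of `allFin n`, over which the induction
-- runs.
foldTree-shift : ∀ {f : Tree → Tree → Tree} (F : A → Tree) {h : A → Fin n → A} g →
  (∀ u i x → f u (F x ∙ shift (toℕ i) g) ≡ F (h x i) ∙ shift (suc (toℕ i)) g) →
  ∀ m j (φ : Fin m → Fin n) → (∀ i → toℕ (φ i) ≡ toℕ i + j) → ∀ x →
  foldTree f (counter m) (F x ∙ shift j g) ≡ F (foldl h x (tabulate φ)) ∙ shift (m + j) g
foldTree-shift F g step zero    j φ φ≡ x = refl
foldTree-shift {f = f} F {h} g step (suc m) j φ φ≡ x =
  trans (cong (foldTree f (counter m)) first)
    (trans (foldTree-shift F g step m (suc j) (φ ∘ suc)
             (λ i → trans (φ≡ (suc i)) (sym (+-suc (toℕ i) j))) _)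
           (cong (λ l → F (foldl h (h x (φ zero)) (tabulate (φ ∘ suc))) ∙ shift l g) (+-suc m j)))
  where
  first : f (nil ∙ counter m) (F x ∙ shift j g) ≡ F (h x (φ zero)) ∙ shift (suc j) g
  first = subst (λ l → f (nil ∙ counter m) (F x ∙ shift l g) ≡ F (h x (φ zero)) ∙ shift (suc l) g)
                (φ≡ zero) (step _ (φ zero) x)

bits-shift-one : ∀ {m} (i : Fin m) → bits m (shift (toℕ i) ((nil ∙ nil) ∙ nil)) ≡ ⁅ i ⁆
bits-shift-one zero    = cong (inside ∷_) (bits-nil _)
bits-shift-one (suc i) = cong (outside ∷_) (bits-shift-one i)

bits-shift-full : ∀ {m l} i → m ≤ l → bits m (shift i (subsetTree (⊤ {l}))) ≡ upper i
bits-shift-full {zero}  zero    m≤l       = refl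
bits-shift-full {zero}  (suc i) m≤l       = refl
bits-shift-full {suc m} zero    (s≤s m≤l) = cong (inside ∷_) (bits-shift-full zero m≤l)
bits-shift-full {suc m} (suc i) m≤l       = cong (outside ∷_) (bits-shift-full i (<⇒≤ m≤l))

-- The extra cons is essential for `n = 0`, where the only set is encoded as `nil` and would be
-- mistaken for the end.
resultTree : Maybe (Subset n) → Tree
resultTree nothing  = nil
resultTree (just X) = subsetTree X ∙ nil

module _ {n : ℕ} (Ψ : CNF n) where

  private
    I′ = cnfTree Ψ

  ─⊆-correct : ∀ (a b c : Expr k) {ρ X Y Z} → bits n (eval a ρ) ≡ X → bits n (eval b ρ) ≡ Y →
               bits n (eval c ρ) ≡ Z → I′ ⊢ ─⊆ᵗ a b c , ρ ↓ boolTree (does (X ─ Y ⊆? Z))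
  ─⊆-correct a b c {ρ} refl refl refl =
    evaluates (trans (subsetStep-correct I′ ρ n (nil ∙ nil) (eval a ρ) (eval b ρ) (eval c ρ)) (lemma _))
    where
    lemma : ∀ b → (ifᵇ b then nil ∙ nil else nil) ≡ boolTree b
    lemma true  = refl
    lemma false = refl

  ─∪-correct : ∀ (a b c : Expr k) {ρ X Y Z} → bits n (eval a ρ) ≡ X → bits n (eval b ρ) ≡ Y →
               bits n (eval c ρ) ≡ Z → I′ ⊢ ─∪ᵗ a b c , ρ ↓ subsetTree ((X ─ Y) ∪ Z)
  ─∪-correct a b c {ρ} {X} {Y} {Z} refl refl refl =
    ↓-bind (evaluates refl)
      (↓-bind {u = nil ∙ subsetTree R}
        (evaluates (trans (cong (λ o → foldTree f (counter n) (o ∙ nil)) merged)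
                     (subst (λ m → foldTree f (counter m) (listTree (os ʳ++ []) ∙ nil) ≡ nil ∙ listTree os)
                            length≡n
                            (trans (reverseStep-correct I′ ρ′ (os ʳ++ []) [])
                                   (cong (λ l → nil ∙ listTree l)
                                         (trans (ʳ++-ʳ++ os) (++-identityʳ os)))))))
        (↓-ret refl))
    where
    R = (X ─ Y) ∪ Z
    os = map boolTree (toList R)
    u₀ = ⟦ traverse nil a b c mergeStep ⟧ᵗ I′ ρ
    ρ′ = u₀ ∷ ρ
    f : Tree → Tree → Tree
    f c a = ⟦ reverseStep ⟧ᵗ I′ (c ∷ a ∷ ρ′)
    merged : head′ u₀ ≡ listTree (os ʳ++ [])
    merged = mergeStep-correct I′ ρ n [] (eval a ρ) (eval b ρ) (eval c ρ)
    length≡n : length (os ʳ++ []) ≡ n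
    length≡n = trans (length-ʳ++ os)
                 (trans (+-identityʳ _) (trans (length-map boolTree (toList R)) (length-toList R)))

  ↓-fold-rounds : ∀ (F : A → Tree) {h x} →
    eval e ρ ≡ F x → (∀ u x → I′ ⊢ t , u ∷ F x ∷ ρ ↓ F (h x)) →
    I′ ⊢ fold variables e t , ρ ↓ F (repeat n h x)
  ↓-fold-rounds {ρ = ρ} {t = t} F {x = x} eq step = evaluates
    (trans (cong (foldTree (λ u a → ⟦ t ⟧ᵗ I′ (u ∷ a ∷ ρ)) (counter n)) eq)
           (foldTree-rounds F (λ u x → value≡ (step u x)) n x))

  ↓-fold-clauses : ∀ (F : A → Tree) {h x} →
    eval e ρ ≡ F x → (∀ C u x → I′ ⊢ t , (clauseTree C ∙ u) ∷ F x ∷ ρ ↓ F (h x C)) →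
    I′ ⊢ fold clauses e t , ρ ↓ F (foldl h x Ψ)
  ↓-fold-clauses {ρ = ρ} {t = t} F {x = x} eq step = evaluates
    (trans (cong (foldTree (λ u a → ⟦ t ⟧ᵗ I′ (u ∷ a ∷ ρ)) (listTree (map clauseTree Ψ))) eq)
           (foldTree-clauses F (λ C u x → value≡ (step C u x)) Ψ x))

  ↓-fold-shift : ∀ (F : A → Tree) {h x} g →
    eval e ρ ≡ F x ∙ g →
    (∀ u i x → I′ ⊢ t , u ∷ (F x ∙ shift (toℕ i) g) ∷ ρ ↓ F (h x i) ∙ shift (suc (toℕ i)) g) →
    I′ ⊢ fold variables e t , ρ ↓ F (foldl h x (allFin n)) ∙ shift (n + 0) g
  ↓-fold-shift {ρ = ρ} {t = t} F {x = x} g eq step = evaluates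
    (trans (cong (foldTree (λ u a → ⟦ t ⟧ᵗ I′ (u ∷ a ∷ ρ)) (counter n)) eq)
           (foldTree-shift F g (λ u i x → value≡ (step u i x)) n 0 (λ i → i)
             (λ i → sym (+-identityʳ (toℕ i))) x))

  fire-correct : ∀ C u X → I′ ⊢ fireᵗ , (clauseTree C ∙ u) ∷ subsetTree X ∷ ρ ↓ subsetTree (fire X C)
  fire-correct {ρ = ρ} C u X =
    -- The general test and merge leave differences with `⊥`, which are removed here.
    ≡-↓ (trans (sym (if-float subsetTree (does (body C ─ ⊥ ⊆? X))))
               (cong subsetTree (cong₂ (λ Y Z → ifᵇ does (Y ⊆? X) then Z ∪ ⁅ head C ⁆ else X)
                                       (p─⊥≡p (body C)) (p─⊥≡p X))))
      (↓-bind (─⊆-correct (hd (hd x₀)) nil x₁ (bits-subsetTree (body C)) (bits-nil n) (bits-subsetTree X))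
        (↓-cond (does (body C ─ ⊥ ⊆? X)) refl
          (─∪-correct x₂ nil (tl (hd x₁)) (bits-subsetTree X) (bits-nil n) (bits-subsetTree ⁅ head C ⁆))
          (↓-ret refl)))

  closure-correct : ∀ (e : Expr k) {ρ X} → eval e ρ ≡ subsetTree X →
                    I′ ⊢ closureᵗ e , ρ ↓ subsetTree (closure Ψ X)
  closure-correct e eq =
    ↓-fold-rounds subsetTree eq λ u X → ↓-fold-clauses subsetTree refl fire-correct

  prune-correct : ∀ u i X → let g = (nil ∙ nil) ∙ nil in
    I′ ⊢ pruneᵗ , u ∷ (subsetTree X ∙ shift (toℕ i) g) ∷ ρ ↓
      subsetTree (prune Ψ X i) ∙ shift (suc (toℕ i)) g
  prune-correct u i X =
    ≡-↓ (trans (sym (if-float (λ Y → subsetTree Y ∙ (nil ∙ shift (toℕ i) ((nil ∙ nil) ∙ nil)))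
                              (does (⁅ i ⁆ ─ ⊥ ⊆? closure Ψ ((X ─ ⁅ i ⁆) ∪ ⊥)))))
               (cong (λ Y → subsetTree Y ∙ shift (suc (toℕ i)) _)
                 (cong₂ (λ E D → ifᵇ does (E ⊆? closure Ψ D) then X else D)
                        (p─⊥≡p ⁅ i ⁆) (∪-identityʳ (X ─ ⁅ i ⁆)))))
      (↓-bind (─∪-correct (hd x₁) (tl x₁) nil (bits-subsetTree X) (bits-shift-one i) (bits-nil n))
        (↓-bind (closure-correct x₀ refl)
          (↓-bind (─⊆-correct (tl x₃) nil x₀ (bits-shift-one i) (bits-nil n) (bits-subsetTree _))
            (↓-cond (does (⁅ i ⁆ ─ ⊥ ⊆? closure Ψ ((X ─ ⁅ i ⁆) ∪ ⊥))) refl (↓-ret refl) (↓-ret refl)))))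

  interior-correct : ∀ (e : Expr k) {ρ X} → eval e ρ ≡ subsetTree X →
                     I′ ⊢ interiorᵗ e , ρ ↓ subsetTree (interior Ψ X)
  interior-correct e eq =
    ↓-fold-rounds subsetTree eq λ u X →
      ↓-bind (↓-fold-shift subsetTree ((nil ∙ nil) ∙ nil) refl prune-correct) (↓-ret refl)

  full-correct : I′ ⊢ fullᵗ , ρ ↓ subsetTree (⊤ {n})
  full-correct {ρ = ρ} = evaluates (trans (ones n 0) (cong (λ m → subsetTree (⊤ {m})) (+-identityʳ n)))
    where
    f : Tree → Tree → Tree
    f u a = (nil ∙ nil) ∙ a
    ones : ∀ m j → foldTree f (counter m) (subsetTree (⊤ {j})) ≡ subsetTree (⊤ {m + j})
    ones zero    j = refl
    ones (suc m) j = trans (ones m (suc j)) (cong (λ l → subsetTree (⊤ {l})) (+-suc m j))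

  firstSet-correct : I′ ⊢ firstSet , [] ↓ resultTree (just (interior Ψ ⊤))
  firstSet-correct = ↓-bind full-correct (↓-bind (interior-correct x₀ refl) (↓-ret refl))

  keepLast-correct : ∀ S u i R → let g = subsetTree (⊤ {n}) in
    I′ ⊢ keepLastᵗ , u ∷ (resultTree R ∙ shift (toℕ i) g) ∷ g ∷ resultTree (just S) ∷ [] ↓
      resultTree (keepLast (admissible Ψ S) (candidate Ψ S) R i) ∙ shift (suc (toℕ i)) g
  keepLast-correct S u i R =
    ≡-↓ (trans (sym (if-∧ b₁))
               (sym (if-float (λ R → resultTree R ∙ shift (suc (toℕ i)) (subsetTree (⊤ {n})))
                              (admissible Ψ S i))))
      (↓-bind (─⊆-correct (tl x₁) (cons nil (tl x₁)) (hd x₃) upper-i upper-suc-i (bits-subsetTree S))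
        (↓-bind (─∪-correct (hd x₄) (tl x₂) (cons nil (tl x₂)) (bits-subsetTree S) upper-i upper-suc-i)
          (↓-bind (interior-correct x₀ refl)
            (↓-bind (─⊆-correct (hd x₆) (tl x₄) x₀ (bits-subsetTree S) upper-i (bits-subsetTree _))
              (↓-cond b₁ refl (↓-cond b₂ refl (↓-ret refl) (↓-ret refl)) (↓-ret refl))))))
    where
    b₁ = does (upper (toℕ i) ─ upper (suc (toℕ i)) ⊆? S)
    b₂ = does (S ─ upper (toℕ i) ⊆? candidate Ψ S i)
    upper-i     = bits-shift-full {n} (toℕ i) ≤-refl
    upper-suc-i = bits-shift-full {n} (suc (toℕ i)) ≤-refl

  nextSet-correct : ∀ S → I′ ⊢ nextSet , resultTree (just S) ∷ [] ↓ resultTree (successor Ψ S)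
  nextSet-correct S =
    ↓-bind full-correct
      (↓-bind (↓-fold-shift resultTree {x = nothing} (subsetTree (⊤ {n})) refl (keepLast-correct S)) (↓-ret refl))

-- The generator

outputs-ticks : ∀ s τ → outputs (ticks s ++ τ) ≡ outputs τ
outputs-ticks zero    τ = refl
outputs-ticks (suc s) τ = outputs-ticks s τ

intervalsFrom-ticks : ∀ t s τ → intervalsFrom t (ticks s ++ τ) ≡ intervalsFrom (s + t) τ
intervalsFrom-ticks t zero    τ = refl
intervalsFrom-ticks t (suc s) τ =
  trans (intervalsFrom-ticks (suc t) s τ) (cong (λ u → intervalsFrom u τ) (+-suc s t))

-- An entry adds at most 4 to the vector and exactly 2 to the counter.
size-subsetTree : ∀ (X : Subset n) → size (subsetTree X) ≤ size (counter n) + size (counter n)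
size-subsetTree []            = s≤s z≤n
size-subsetTree {n = suc n} (b ∷ X) = begin
  suc (size (boolTree b) + size (subsetTree X))
    ≤⟨ s≤s (+-mono-≤ (size-boolTree b) (size-subsetTree X)) ⟩
  4 + (size (counter n) + size (counter n))
    ≡⟨ rearrange (size (counter n)) ⟩
  size (counter (suc n)) + size (counter (suc n)) ∎
  where
  open ≤-Reasoning
  size-boolTree : ∀ b → size (boolTree b) ≤ 3
  size-boolTree false = s≤s z≤n
  size-boolTree true  = ≤-refl
  rearrange : ∀ c → 4 + (c + c) ≡ (2 + c) + (2 + c)
  rearrange = solve-∀

size-counter≤size-cnfTree : ∀ (Ψ : CNF n) → size (counter n) ≤ size (cnfTree Ψ)
size-counter≤size-cnfTree Ψ = m≤n⇒m≤1+n (m≤m+n _ _)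

module Generator (initial : Term 0) (following : Term 1) where

  loopBody : Cmd 2
  loopBody = emit (hd (hd W)) ⨾ compile following ⨾ stackReg := popSecond

  loop : Cmd 2
  loop = while hd W loop loopBody

  generator : Program
  generator = program 1 (compile initial ⨾ loop)

  -- 13 = 7 + 3 + 3, for dropping the previous set from the stack, the loop
  -- test and evaluating the output, whose size is at most twice that of the input.
  delay : Polynomial
  delay = bound initial ⊕ (bound following ⊕ (13 ∷ 2 ∷ []))

module Correctness (initial : Term 0) (following : Term 1) {n : ℕ} (Ψ : CNF n)
  (initial-correct : cnfTree Ψ ⊢ initial , [] ↓ resultTree (just (interior Ψ ⊤)))
  (next-correct : ∀ S → cnfTree Ψ ⊢ following , resultTree (just S) ∷ [] ↓ resultTree (successor Ψ S))
  where

  open Generator initial following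

  private
    I′ = cnfTree Ψ
    N  = size I′
    D  = delay at N

  -- The time before a loop test is spent either on the first set or on a successor; the sum covers
  -- both.
  idle : ℕ
  idle = bound initial at N + (bound following at N + 7)

  idle+output≤delay : ∀ (X : Subset n) → idle + (6 + size (subsetTree X)) ≤ D
  idle+output≤delay X = begin
    idle + (6 + size (subsetTree X))
      ≤⟨ +-monoʳ-≤ idle (+-monoʳ-≤ 6 (≤-trans (size-subsetTree X) (+-mono-≤ c≤N c≤N))) ⟩
    idle + (6 + (N + N))
      ≡⟨ rearrange (bound initial at N) (bound following at N) N ⟩
    bound initial at N + (bound following at N + (13 ∷ 2 ∷ []) at N)
      ≡⟨ cong (bound initial at N +_) (⊕-at (bound following) (13 ∷ 2 ∷ []) N) ⟨
    bound initial at N + (bound following ⊕ (13 ∷ 2 ∷ [])) at N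
      ≡⟨ ⊕-at (bound initial) (bound following ⊕ (13 ∷ 2 ∷ [])) N ⟨
    D ∎
    where
    open ≤-Reasoning
    c≤N = size-counter≤size-cnfTree Ψ
    rearrange : ∀ a b x → (a + (b + 7)) + (6 + (x + x)) ≡ a + (b + (13 + x * (2 + x * 0)))
    rearrange = solve-∀

  -- The remaining run from a loop test on. The interval open at that moment began earlier, hence
  -- the time `t` already spent in `intervals≤`.
  record Enumeration (r : Maybe (Subset n)) (Required : Subset n → Set) : Set where
    field
      trace      : Trace
      final      : Store 2
      runs       : ⟨ loop , config I′ (resultTree r ∷ []) ⟩⇓⟨ trace , final ⟩
      objects    : List (Subset n)
      outputs≡   : outputs trace ≡ map subsetTree objects
      required   : ∀ X → X ∈ˡ objects ⇔ Required X
      unique     : Unique objects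
      intervals≤ : ∀ t → t ≤ idle → All (_≤ D) (intervalsFrom t trace)

  done : Enumeration nothing (λ _ → Empty.⊥)
  done = record
    { runs       = ⇓-while-false refl
    ; objects    = []
    ; outputs≡   = refl
    ; required   = λ X → mk⇔ (λ ()) (λ ())
    ; unique     = []
    -- The last interval ends with a failing test of cost 3; the bound for an interval that ends
    -- with the output of `⊤` is more than enough.
    ; intervals≤ = λ t t≤ →
        ≤-trans (+-mono-≤ {x = 3} {y = 6} (s≤s (s≤s (s≤s z≤n))) t≤)
          (≤-trans (≤-reflexive (+-comm 6 idle))
            (≤-trans (+-monoʳ-≤ idle (m≤m+n 6 (size (subsetTree (⊤ {n}))))) (idle+output≤delay (⊤ {n}))))
        ∷ []
    }

  output-next : ∀ {S Required Required′} → Enumeration (successor Ψ S) Required → ¬ Required S →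
                (∀ X → Required′ X ⇔ (X ≡ S ⊎ Required X)) → Enumeration (just S) Required′
  output-next {S} {Required} {Required′} E S∉ spec = record
    { trace      = ticks 3 ++ ((ticks (3 + o) ++ output (subsetTree S) ∷ []) ++ ticks l) ++ trace
    ; runs       = ⇓-while-true (λ ()) (⇓-seq ⇓-emit (proj₂ (proj₂ computeNext))) runs
    ; objects    = S ∷ objects
    ; outputs≡   = trans (cong outputs regroup)
                     (trans (outputs-ticks (3 + o) _)
                       (cong (subsetTree S ∷_) (trans (outputs-ticks l trace) outputs≡)))
    ; required   = λ X → mk⇔ (from (spec X) ∘ ∈⇒) (⇒∈ ∘ to (spec X))
    ; unique     = All.tabulate (λ X∈ S≡X → S∉ (subst Required (sym S≡X) (to (required _) X∈))) ∷ unique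
    ; intervals≤ = λ t t≤ → subst (All (_≤ D)) (sym (split t))
        (≤-trans (first t t≤) (idle+output≤delay S) ∷ intervals≤ (l + 0) l≤)
    }
    where
    open Enumeration E
    o = size (subsetTree S)
    computeNext = silent-seq (evaluates⇒silent (next-correct S)) (silent-assign refl)
    l = proj₁ computeNext
    l≤ : l + 0 ≤ idle
    l≤ = ≤-trans (≤-reflexive (+-identityʳ l)) (≤-trans (proj₁ (proj₂ computeNext)) (m≤n+m _ (bound initial at N)))
    regroup : ticks 3 ++ ((ticks (3 + o) ++ output (subsetTree S) ∷ []) ++ ticks l) ++ trace ≡
              ticks 3 ++ ticks (3 + o) ++ output (subsetTree S) ∷ ticks l ++ trace
    regroup = cong (ticks 3 ++_)
      (trans (cong (_++ trace) (++-assoc (ticks (3 + o)) (output (subsetTree S) ∷ []) (ticks l)))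
             (++-assoc (ticks (3 + o)) (output (subsetTree S) ∷ ticks l) trace))
    split : ∀ t → intervalsFrom t (ticks 3 ++ ((ticks (3 + o) ++ output (subsetTree S) ∷ []) ++ ticks l) ++ trace) ≡
                  ((3 + o) + (3 + t)) ∷ intervalsFrom (l + 0) trace
    split t = trans (cong (intervalsFrom t) regroup)
      (trans (intervalsFrom-ticks (3 + t) (3 + o) _)
             (cong ((3 + o) + (3 + t) ∷_) (intervalsFrom-ticks 0 l trace)))
    first : ∀ t → t ≤ idle → (3 + o) + (3 + t) ≤ idle + (6 + o)
    first t t≤ = ≤-trans (≤-reflexive (rearrange o t)) (+-monoˡ-≤ (6 + o) t≤)
      where
      rearrange : ∀ o t → (3 + o) + (3 + t) ≡ t + (6 + o)
      rearrange = solve-∀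
    ∈⇒ : ∀ {X} → X ∈ˡ S ∷ objects → X ≡ S ⊎ Required X
    ∈⇒ (here X≡S)  = inj₁ X≡S
    ∈⇒ (there X∈)  = inj₂ (to (required _) X∈)
    ⇒∈ : ∀ {X} → X ≡ S ⊎ Required X → X ∈ˡ S ∷ objects
    ⇒∈ (inj₁ X≡S) = here X≡S
    ⇒∈ (inj₂ req) = there (from (required _) req)

  -- What remains to be listed when `S` is the current set.
  UpTo : Subset n → Subset n → Set
  UpTo S X = SelfSupporting Ψ X × (X ≡ S ⊎ X ≺ S)

  enumerate : ∀ S → Acc _<_ (value S) → SelfSupporting Ψ S → Enumeration (just S) (UpTo S)
  enumerate S (acc smaller) sup = continue (successor-correct Ψ S) refl
    where
    -- The equation lets `r` be refined by matching while keeping its link to the computed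
    -- successor.
    continue : ∀ {r} → Successor Ψ S r → successor Ψ S ≡ r → Enumeration (just S) (UpTo S)
    continue (last none) eq =
      output-next (subst (λ r → Enumeration r (λ _ → Empty.⊥)) (sym eq) done) (λ ()) λ X → mk⇔
        (λ { (_    , inj₁ X≡S) → inj₁ X≡S
           ; (supX , inj₂ X≺S) → contradiction X≺S (none supX) })
        (λ { (inj₁ refl) → sup , inj₁ refl })
    continue (next {S′} sup′ (i , d) between) eq =
      output-next
        (subst (λ r → Enumeration r (UpTo S′)) (sym eq)
          (enumerate S′ (smaller (differ⇒value< d)) sup′))
        (λ { (_ , inj₁ refl)    → <-irrefl refl (differ⇒value< d)
           ; (_ , inj₂ (_ , e)) → <-asym (differ⇒value< d) (differ⇒value< e) })
        λ X → mk⇔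
          (λ { (_    , inj₁ X≡S) → inj₁ X≡S
             ; (supX , inj₂ X≺S) → inj₂ (supX , between supX X≺S) })
          (λ { (inj₁ refl)                    → sup , inj₁ refl
             ; (inj₂ (supX , inj₁ refl))      → supX , inj₂ (i , d)
             ; (inj₂ (supX , inj₂ (_ , e)))   → supX , inj₂ (differ-≺ e d) })

  generates : GeneratesWithDelay generator I′ subsetTree (IsImplicateSet Ψ) D
  generates = record
    { trace      = ticks t₀ ++ trace
    ; runs       = final , ⇓-seq (proj₂ (proj₂ computeFirst)) runs
    ; objects    = objects
    ; outputs≡   = trans (outputs-ticks t₀ trace) outputs≡
    ; required   = λ X → mk⇔
        (from (implicateSet⇔ Ψ X) ∘ proj₁ ∘ to (required X))
        (from (required X) ∘ upTo ∘ to (implicateSet⇔ Ψ X))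
    ; unique     = unique
    ; intervals≤ = subst (All (_≤ D)) (sym (intervalsFrom-ticks 0 t₀ trace)) (intervals≤ (t₀ + 0) t₀≤)
    }
    where
    S₀ = interior Ψ ⊤
    open Enumeration (enumerate S₀ (<-wellFounded (value S₀)) (interior-selfSupporting Ψ ⊤))
    computeFirst = evaluates⇒silent initial-correct
    t₀ = proj₁ computeFirst
    t₀≤ : t₀ + 0 ≤ idle
    t₀≤ = ≤-trans (≤-reflexive (+-identityʳ t₀)) (≤-trans (proj₁ (proj₂ computeFirst)) (m≤m+n _ _))
    upTo : ∀ {X} → SelfSupporting Ψ X → UpTo S₀ X
    -- Every implicate set is included in the interior of the whole set, so none comes before the
    -- first output.
    upTo supX = supX , ⊆⇒≡⊎≺ (interior-greatest Ψ supX ⊆⊤)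

theorem31 : Σ[ P ∈ Program ] Σ[ p ∈ Polynomial ]
    (∀ (n : ℕ) (Ψ : CNF n) →
    GeneratesWithDelay P (cnfTree Ψ) subsetTree (IsImplicateSet Ψ)
    (p at size (cnfTree Ψ)))
theorem31 = Generator.generator firstSet nextSet , Generator.delay firstSet nextSet , λ n Ψ →
  Correctness.generates firstSet nextSet Ψ (firstSet-correct Ψ) (nextSet-correct Ψ)
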